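{- For every online scheduling algorithm there exists a feasible job stream (with speed functions $f_j(t)=t-r_j$) on which the algorithm misses the due date of at least one job, i.e., some job $j$ has completion time $C_j>d_j$.
   Context: Jobs $j$ have release time $r_j$, due date $d_j>r_j$, work $w_j>0$, and speed function $f_j(t)=t-r_j$ for $t\ge r_j$. A single processor runs at most one job at a time, preemption is allowed, and running job $j$ during a set of times $S$ completes $\int_S f_j(t)\,dt$ units of its work; $C_j$ is the time at which job $j$'s work $w_j$ is completed. A job stream is feasible if there exists a schedule in which every job runs only within $[r_j,d_j]$ and completes by $d_j$. In the online setting, job $j$ (together with $w_j$ and $d_j$) becomes known to the algorithm only at time $r_j$, and the algorithm's decisions up to time $t$ may depend only on jobs released by time $t$. -}

module Defs where

open import Level using (0ℓ) renaming (suc to lsuc)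
open import Algebra.Structures using (IsCommutativeRing)
open import Data.Fin using (Fin; toℕ)
open import Data.List using (List; []; _∷_; length; lookup; filter)
open import Data.List.Relation.Unary.AllPairs using (AllPairs)
open import Data.Maybe using (Maybe; just) renaming (map to mapMaybe)
open import Data.Nat using (ℕ; zero; suc)
open import Data.Product using (∃; ∃-syntax; _×_)
open import Relation.Binary.PropositionalEquality using (_≡_; _≢_)
open import Relation.Binary.Structures using (IsDecTotalOrder)
open import Relation.Nullary using (¬_)
open import Relation.Unary using (Pred; _∈_; _⊆_; _∩_; ∁)

module Bounds {A : Set} (_≤_ : A → A → Set) where

  IsUpperBound IsLowerBound : ∀ {ℓ} → Pred A ℓ → A → Set ℓ
  IsUpperBound P u = ∀ x → P x → x ≤ u
  IsLowerBound P l = ∀ x → P x → l ≤ x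

  IsSup IsInf : ∀ {ℓ} → Pred A ℓ → A → Set ℓ
  IsSup P s = IsUpperBound P s × (∀ u → IsUpperBound P u → s ≤ u)
  IsInf P i = IsLowerBound P i × (∀ l → IsLowerBound P l → l ≤ i)

-- The axioms of the classical real numbers, which determine them up to
-- isomorphism.  Completeness is required for predicates in Set₁ because the
-- lower sums defining the Lebesgue integral form such a predicate.
record RealNumbers : Set (lsuc (lsuc 0ℓ)) where
  infixl 7 _*_
  infixl 6 _+_ _-_
  infix  8 -_
  infix  4 _≤_ _<_
  field
    ℝ       : Set
    _+_ _*_ : ℝ → ℝ → ℝ
    -_      : ℝ → ℝ
    0# 1#   : ℝ
    _≤_     : ℝ → ℝ → Set

    isCommutativeRing : IsCommutativeRing _≡_ _+_ _*_ -_ 0# 1#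
    0≢1               : 0# ≢ 1#
    inverse           : ∀ x → x ≢ 0# → ∃[ y ] x * y ≡ 1#

    isDecTotalOrder   : IsDecTotalOrder _≡_ _≤_
    +-monoˡ-≤         : ∀ z {x y} → x ≤ y → x + z ≤ y + z
    *-nonNegative     : ∀ {x y} → 0# ≤ x → 0# ≤ y → 0# ≤ x * y

  open Bounds _≤_ public

  field
    complete : (P : Pred ℝ (lsuc 0ℓ)) → ∃ P → ∃ (IsUpperBound P) → ∃ (IsSup P)

  open IsDecTotalOrder isDecTotalOrder public using (_≤?_)

  _<_ : ℝ → ℝ → Set
  x < y = x ≤ y × x ≢ y

  _-_ : ℝ → ℝ → ℝ
  x - y = x + (- y)

module Lebesgue (R : RealNumbers) where
  open RealNumbers R

  Subset : Set₁
  Subset = Pred ℝ 0ℓ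

  Disjoint : Subset → Subset → Set
  Disjoint E F = ∀ t → ¬ (t ∈ E × t ∈ F)

  ∑< : ℕ → (ℕ → ℝ) → ℝ
  ∑< zero    a = 0#
  ∑< (suc n) a = ∑< n a + a n

  -- The open intervals (left n , right n) cover A and their lengths have
  -- sum at most `total`.
  record Cover (A : Subset) (total : ℝ) : Set where
    field
      left right : ℕ → ℝ
      left≤right : ∀ n → left n ≤ right n
      covers     : ∀ t → t ∈ A → ∃[ n ] (left n < t × t < right n)
      sum≤total  : ∀ N → ∑< N (λ n → right n - left n) ≤ total

  -- Lebesgue outer measure as a relation; a set of infinite outer measure is
  -- related to no real number.
  OuterMeasure : Subset → ℝ → Set
  OuterMeasure A m = IsInf (Cover A) m

  -- Carathéodory's criterion.  It only has content for test sets A of finite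
  -- outer measure, and then A ∩ E and A ∖ E have finite outer measure too.
  Measurable : Subset → Set₁
  Measurable E = ∀ (A : Subset) {m m₁ m₂} → OuterMeasure A m →
    OuterMeasure (A ∩ E) m₁ → OuterMeasure (A ∩ ∁ E) m₂ → m ≡ m₁ + m₂

  -- One summand  height · 1_part  of a simple function that is bounded by
  -- f · 1_S.
  record Piece (f : ℝ → ℝ) (S : Subset) : Set₁ where
    field
      height     : ℝ
      part       : Subset
      size       : ℝ
      0≤height   : 0# ≤ height
      part⊆S     : part ⊆ S
      height≤f   : ∀ t → t ∈ part → height ≤ f t
      measurable : Measurable part
      measure    : OuterMeasure part size

  simpleIntegral : ∀ {f S} → List (Piece f S) → ℝ
  simpleIntegral []       = 0#
  simpleIntegral (p ∷ ps) = Piece.height p * Piece.size p + simpleIntegral ps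

  LowerSum : (ℝ → ℝ) → Subset → Pred ℝ (lsuc 0ℓ)
  LowerSum f S s = ∃[ ps ]
    AllPairs (λ p q → Disjoint (Piece.part p) (Piece.part q)) ps ×
    s ≡ simpleIntegral {f} {S} ps

  -- ∫_S f(t) dt = v, for measurable S and f continuous and nonnegative on S:
  -- the supremum of the integrals of the simple functions below f · 1_S.
  Integral : (ℝ → ℝ) → Subset → ℝ → Set₁
  Integral f S v = IsSup (LowerSum f S) v

module Scheduling (R : RealNumbers) where
  open RealNumbers R
  open Lebesgue R

  Time : Set
  Time = ℝ

  record Job : Set where
    field
      release     : Time
      due         : Time
      work        : ℝ
      .release<due : release < due
      .0<work      : 0# < work
  open Job public

  speed : Job → Time → ℝ
  speed j t = t - release j

  -- Jobs are listed in order of release (ties in any order) and are referred to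
  -- by their position.
  record JobStream : Set where
    field
      jobs   : List Job
      sorted : AllPairs (λ i j → release i ≤ release j) jobs
  open JobStream public

  JobOf : JobStream → Set
  JobOf J = Fin (length (jobs J))

  job : (J : JobStream) → JobOf J → Job
  job J = lookup (jobs J)

  -- The position of the job being run at each time; `nothing` means idle.
  Schedule : Set
  Schedule = Time → Maybe ℕ

  RunsAt : Schedule → ℕ → Subset
  RunsAt σ j t = σ t ≡ just j

  RunsUntil : (J : JobStream) → Schedule → JobOf J → Time → Subset
  RunsUntil J σ j T t = RunsAt σ (toℕ j) t × release (job J j) ≤ t × t ≤ T

  WorkDone : (J : JobStream) → Schedule → JobOf J → Time → ℝ → Set₁
  WorkDone J σ j T v = Integral (speed (job J j)) (RunsUntil J σ j T) v

  CompletedBy : (J : JobStream) → Schedule → JobOf J → Time → Set₁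
  CompletedBy J σ j T = ∃[ v ] WorkDone J σ j T v × work (job J j) ≤ v

  -- C_j is the least T with CompletedBy J σ j T, and is infinite if there is no
  -- such T.  Hence C_j > d_j says that every such T is later than d_j.
  MissesDueDate : (J : JobStream) → Schedule → JobOf J → Set₁
  MissesDueDate J σ j = ∀ T → CompletedBy J σ j T → due (job J j) < T

  record FeasibleSchedule (J : JobStream) (σ : Schedule) : Set₁ where
    field
      measurable   : ∀ j → Measurable (RunsAt σ j)
      withinWindow : ∀ (j : JobOf J) t → t ∈ RunsAt σ (toℕ j) →
                     release (job J j) ≤ t × t ≤ due (job J j)
      meetsDueDate : ∀ (j : JobOf J) → CompletedBy J σ j (due (job J j))

  Feasible : JobStream → Set₁
  Feasible J = ∃[ σ ] FeasibleSchedule J σ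

  releasedBy : Time → List Job → List Job
  releasedBy t = filter (λ j → release j ≤? t)

  -- The decision at time t is a function of t and of the jobs released by time
  -- t.  This covers dependence on earlier decisions as well, because those are
  -- themselves determined by the released jobs.  As streams are sorted by
  -- release, releasedBy t yields a prefix, so positions in it are positions in
  -- the stream.
  Policy : Set
  Policy = Time → (known : List Job) → Maybe (Fin (length known))

  scheduleOf : Policy → JobStream → Schedule
  scheduleOf decide J t = mapMaybe toℕ (decide t (releasedBy t (jobs J)))

  record OnlineAlgorithm : Set₁ where
    field
      decide     : Policy
      measurable : ∀ J j → Measurable (RunsAt (scheduleOf decide J) j)

  run : OnlineAlgorithm → JobStream → Schedule
  run alg = scheduleOf (OnlineAlgorithm.decide alg)

{-# OPTIONS --safe #-}
module Submission where

-- The adversary releases job 0 at time 1 and job 1 at time 24 and watches how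
-- much of job 1 the algorithm does by time 66.  Running both jobs back to back
-- is most efficient with job 1 last, since the later released job should get as
-- little processor time as possible.  If the algorithm has done much of job 1,
-- a long third job leaves no room for this inefficiency.  If it has done
-- little, a short third job that is due together with job 1 blocks job 1.
--
-- Time is cut into unit cells (k , k + 1].  The time that a schedule gives to a
-- job within a cell is the outer measure of a measurable set, so over all jobs
-- it sums to at most 1 in each cell, and a job's work is at most the sum over
-- the cells of this time multiplied by the largest speed in the cell.  The
-- numbers leave enough slack for these upper sums, and for lower sums over unit
-- cells on the side of feasibility, so the rest is weak linear programming
-- duality with integer data.

open import Defs
open import Algebra.Bundles using (CommutativeRing)
open import Algebra.Solver.Ring.AlmostCommutativeRing using (fromCommutativeRing; _-Raw-AlmostCommutative⟶_)
import Data.Bool as Bool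
open import Data.Empty using (⊥; ⊥-elim)
open import Data.Fin using (toℕ)
open import Data.Fin.Patterns using (0F; 1F; 2F)
open import Data.Integer using (ℤ; -[1+_]; _⊖_)
open import Data.List using (List; []; _∷_; _++_)
open import Data.List.Properties using (filter-++; filter-reject; ++-identityʳ)
open import Data.List.Relation.Unary.All using (All; []; _∷_)
open import Data.List.Relation.Unary.AllPairs using (AllPairs; []; _∷_)
open import Data.Maybe using (Maybe; just; nothing) renaming (map to mapMaybe)
open import Data.Maybe.Properties using (just-injective)
open import Data.Nat using (ℕ; zero; suc)
open import Data.Product using (∃; ∃-syntax; _×_; _,_; proj₁; proj₂)
open import Data.Sum using (_⊎_; inj₁; inj₂; [_,_]′)
open import Function using (_∘_)
open import Level using (0ℓ; Lift; lift) renaming (suc to lsuc)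
open import Relation.Binary.Bundles using (Poset; TotalOrder; DecTotalOrder)
open import Relation.Binary.PropositionalEquality using (_≡_; _≢_; refl; sym; trans; cong; cong₂; subst; subst₂; module ≡-Reasoning)
open import Relation.Binary.Structures using (IsDecTotalOrder)
open import Relation.Nullary using (¬_; Dec; yes; no)
open import Relation.Unary using (Pred; Decidable; _∈_; _∩_; ∁)
import Algebra.Construct.NaturalChoice.Max as Max
import Algebra.Construct.NaturalChoice.Min as Min
import Algebra.Properties.Ring as RingProperties
import Algebra.Properties.Semiring.Mult as SemiringMult
import Algebra.Solver.Ring as RingSolver
import Data.Integer as ℤ
import Data.Integer.Properties as ℤ
import Data.List.Relation.Unary.All as All
import Data.Nat as ℕ
import Data.Nat.Properties as ℕ
import Relation.Binary.Reasoning.PartialOrder as PosetReasoning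

-- Ordered field arithmetic and the embedding of the natural numbers.

module OrderedField (R : RealNumbers) where
  open RealNumbers R

  commutativeRing : CommutativeRing 0ℓ 0ℓ
  commutativeRing = record { isCommutativeRing = isCommutativeRing }

  open CommutativeRing commutativeRing public
    using (+-assoc; +-comm; +-identityˡ; +-identityʳ; -‿inverseʳ; *-assoc; *-comm; *-identityˡ; *-identityʳ;
           distribˡ; distribʳ; zeroˡ; zeroʳ)
  open RingProperties (CommutativeRing.ring commutativeRing) using (-‿+-comm; -‿distribˡ-*; -‿distribʳ-*; -‿involutive; -0#≈0#)
  open SemiringMult (CommutativeRing.semiring commutativeRing) using (×-homo-+; ×1-homo-*) renaming (_×_ to _·_)

  ι : ℕ → ℝ
  ι n = n · 1#

  ι-+ : ∀ m n → ι (m ℕ.+ n) ≡ ι m + ι n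
  ι-+ = ×-homo-+ 1#

  ι-* : ∀ m n → ι (m ℕ.* n) ≡ ι m * ι n
  ι-* = ×1-homo-*

  private
    -- Integer coefficients have decidable equality, which lets the ring solver recognise terms that
    -- cancel.
    ιℤ : ℤ → ℝ
    ιℤ (ℤ.+ n)  = ι n
    ιℤ -[1+ n ] = - ι (suc n)

    ιℤ-neg : ∀ z → ιℤ (ℤ.- z) ≡ - ιℤ z
    ιℤ-neg (ℤ.+ zero)  = sym -0#≈0#
    ιℤ-neg (ℤ.+ suc n) = refl
    ιℤ-neg -[1+ n ]    = sym (-‿involutive _)

    cancel : ∀ x y → x - y ≡ (1# + x) - (1# + y)
    cancel x y = sym (trans (cong ((1# + x) +_) (sym (-‿+-comm 1# y)))
      (trans (cong (_+ (- 1# + - y)) (+-comm 1# x))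
      (trans (+-assoc x 1# _) (cong (x +_)
      (trans (sym (+-assoc 1# (- 1#) (- y)))
      (trans (cong (_+ - y) (-‿inverseʳ 1#)) (+-identityˡ _)))))))

    ιℤ-⊖ : ∀ m n → ιℤ (m ⊖ n) ≡ ι m - ι n
    ιℤ-⊖ zero    zero    = sym (-‿inverseʳ 0#)
    ιℤ-⊖ zero    (suc n) = sym (+-identityˡ _)
    ιℤ-⊖ (suc m) zero    = sym (trans (cong (ι (suc m) +_) -0#≈0#) (+-identityʳ _))
    ιℤ-⊖ (suc m) (suc n) = trans (cong ιℤ (ℤ.[1+m]⊖[1+n]≡m⊖n m n)) (trans (ιℤ-⊖ m n) (cancel (ι m) (ι n)))

    ιℤ-+ : ∀ x y → ιℤ (x ℤ.+ y) ≡ ιℤ x + ιℤ y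
    ιℤ-+ (ℤ.+ m)  (ℤ.+ n)  = ι-+ m n
    ιℤ-+ (ℤ.+ m)  -[1+ n ] = ιℤ-⊖ m (suc n)
    ιℤ-+ -[1+ m ] (ℤ.+ n)  = trans (ιℤ-⊖ n (suc m)) (+-comm _ _)
    ιℤ-+ -[1+ m ] -[1+ n ] = trans
      (cong -_ (trans (cong ι (sym (ℕ.+-suc (suc m) n))) (ι-+ (suc m) (suc n)))) (sym (-‿+-comm _ _))

    ιℤ-*-nonNegˡ : ∀ m z → ιℤ (ℤ.+ m ℤ.* z) ≡ ι m * ιℤ z
    ιℤ-*-nonNegˡ m (ℤ.+ n)  = trans (cong ιℤ (sym (ℤ.pos-* m n))) (ι-* m n)
    ιℤ-*-nonNegˡ m -[1+ n ] = trans (cong ιℤ (sym (ℤ.neg-distribʳ-* (ℤ.+ m) (ℤ.+ suc n)))) (trans (ιℤ-neg (ℤ.+ m ℤ.* ℤ.+ suc n))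
      (trans (cong -_ (ιℤ-*-nonNegˡ m (ℤ.+ suc n))) (-‿distribʳ-* _ _)))

    ιℤ-* : ∀ x y → ιℤ (x ℤ.* y) ≡ ιℤ x * ιℤ y
    ιℤ-* (ℤ.+ m)  y = ιℤ-*-nonNegˡ m y
    ιℤ-* -[1+ m ] y = trans (cong ιℤ (sym (ℤ.neg-distribˡ-* (ℤ.+ suc m) y))) (trans (ιℤ-neg (ℤ.+ suc m ℤ.* y))
      (trans (cong -_ (ιℤ-*-nonNegˡ (suc m) y)) (-‿distribˡ-* _ _)))

    morphism : ℤ.+-*-rawRing -Raw-AlmostCommutative⟶ fromCommutativeRing commutativeRing
    morphism = record
      { ⟦_⟧ = ιℤ ; +-homo = ιℤ-+ ; *-homo = ιℤ-* ; -‿homo = ιℤ-neg ; 0-homo = refl ; 1-homo = +-identityʳ 1# }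

    coefficient≟ : ∀ x y → Maybe (ιℤ x ≡ ιℤ y)
    coefficient≟ x y with x ℤ.≟ y
    ... | yes x≡y = just (cong ιℤ x≡y)
    ... | no _    = nothing

  open RingSolver ℤ.+-*-rawRing (fromCommutativeRing commutativeRing) morphism coefficient≟ public
    using (solve; _:+_; _:*_; _:-_; :-_; _:=_; con)

  open IsDecTotalOrder isDecTotalOrder public
    using () renaming (refl to ≤-refl; reflexive to ≤-reflexive; trans to ≤-trans; antisym to ≤-antisym; total to ≤-total)

  poset : Poset 0ℓ 0ℓ 0ℓ
  poset = DecTotalOrder.poset (record { isDecTotalOrder = isDecTotalOrder })

  module ≤-Reasoning = PosetReasoning poset

  <⇒≤ : ∀ {x y} → x < y → x ≤ y
  <⇒≤ = proj₁

  <⇒≱ : ∀ {x y} → x < y → ¬ (y ≤ x)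
  <⇒≱ (x≤y , x≢y) y≤x = x≢y (≤-antisym x≤y y≤x)

  ≰⇒> : ∀ {x y} → ¬ (x ≤ y) → y < x
  ≰⇒> {x} {y} x≰y with ≤-total x y
  ... | inj₁ x≤y = ⊥-elim (x≰y x≤y)
  ... | inj₂ y≤x = y≤x , λ y≡x → x≰y (≤-reflexive (sym y≡x))

  ≮⇒≥ : ∀ {x y} → ¬ (x < y) → y ≤ x
  ≮⇒≥ {x} {y} x≮y with y ≤? x
  ... | yes y≤x = y≤x
  ... | no y≰x  = ⊥-elim (x≮y (≰⇒> y≰x))

  <-≤-trans : ∀ {x y z} → x < y → y ≤ z → x < z
  <-≤-trans x<y y≤z = ≰⇒> λ z≤x → <⇒≱ x<y (≤-trans y≤z z≤x)

  ≤-<-trans : ∀ {x y z} → x ≤ y → y < z → x < z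
  ≤-<-trans x≤y y<z = ≰⇒> λ z≤x → <⇒≱ y<z (≤-trans z≤x x≤y)

  +-mono-≤ : ∀ {w x y z} → w ≤ x → y ≤ z → w + y ≤ x + z
  +-mono-≤ {w} {x} {y} {z} w≤x y≤z = ≤-trans (+-monoˡ-≤ y w≤x) (subst₂ _≤_ (+-comm y x) (+-comm z x) (+-monoˡ-≤ x y≤z))

  +-monoʳ-≤ : ∀ z {x y} → x ≤ y → z + x ≤ z + y
  +-monoʳ-≤ z = +-mono-≤ ≤-refl

  -- Every linear consequence of a ≤ b is an instance, the equation being left to
  -- the ring solver.
  rearrange : ∀ {a b x y} → x + b ≡ y + a → a ≤ b → x ≤ y
  rearrange {a} {b} {x} {y} eq a≤b = subst₂ _≤_ (+-cancelʳ x a) (+-cancelʳ y a)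
    (+-monoˡ-≤ (- a) (≤-trans (+-monoʳ-≤ x a≤b) (≤-reflexive eq)))
    where
    +-cancelʳ : ∀ x y → (x + y) - y ≡ x
    +-cancelʳ = solve 2 (λ x y → (x :+ y) :- y := x) refl

  x≤x+y : ∀ {x y} → 0# ≤ y → x ≤ x + y
  x≤x+y {x} 0≤y = ≤-trans (≤-reflexive (sym (+-identityʳ x))) (+-monoʳ-≤ x 0≤y)

  telescope : ∀ x y z → (z - y) + (y - x) ≡ z - x
  telescope = solve 3 (λ x y z → (z :- y) :+ (y :- x) := z :- x) refl

  -‿anti-mono : ∀ {x y} → x ≤ y → - y ≤ - x
  -‿anti-mono {x} {y} = rearrange (solve 2 (λ x y → :- y :+ y := :- x :+ x) refl x y)

  0≤1 : 0# ≤ 1#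
  0≤1 with ≤-total 0# 1#
  ... | inj₁ 0≤1 = 0≤1
  ... | inj₂ 1≤0 = subst (0# ≤_) (trans (solve 1 (λ x → :- x :* :- x := x :* x) refl 1#) (*-identityʳ 1#)) (*-nonNegative 0≤-1 0≤-1)
    where
    0≤-1 : 0# ≤ - 1#
    0≤-1 = rearrange (solve 1 (λ x → con (ℤ.+ 0) :+ con (ℤ.+ 0) := :- x :+ x) refl 1#) 1≤0

  x≤y⇒0≤y-x : ∀ {x y} → x ≤ y → 0# ≤ y - x
  x≤y⇒0≤y-x {x} {y} = rearrange (solve 2 (λ x y → con (ℤ.+ 0) :+ y := (y :- x) :+ x) refl x y)

  0≤y-x⇒x≤y : ∀ {x y} → 0# ≤ y - x → x ≤ y
  0≤y-x⇒x≤y {x} {y} = rearrange (solve 2 (λ x y → x :+ (y :- x) := y :+ con (ℤ.+ 0)) refl x y)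

  *-monoˡ-≤-nonNeg : ∀ {x y z} → 0# ≤ z → x ≤ y → x * z ≤ y * z
  *-monoˡ-≤-nonNeg {x} {y} {z} 0≤z x≤y = 0≤y-x⇒x≤y
    (subst (0# ≤_) (solve 3 (λ x y z → (y :- x) :* z := y :* z :- x :* z) refl x y z) (*-nonNegative (x≤y⇒0≤y-x x≤y) 0≤z))

  *-monoʳ-≤-nonNeg : ∀ {x y z} → 0# ≤ z → x ≤ y → z * x ≤ z * y
  *-monoʳ-≤-nonNeg {x} {y} {z} 0≤z x≤y = subst₂ _≤_ (*-comm x z) (*-comm y z) (*-monoˡ-≤-nonNeg 0≤z x≤y)

  0≤ι : ∀ n → 0# ≤ ι n
  0≤ι zero    = ≤-refl
  0≤ι (suc n) = ≤-trans (≤-reflexive (sym (+-identityʳ 0#))) (+-mono-≤ 0≤1 (0≤ι n))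

  ι-mono-≤ : ∀ {m n} → m ℕ.≤ n → ι m ≤ ι n
  ι-mono-≤ {n = n} ℕ.z≤n = 0≤ι n
  ι-mono-≤ (ℕ.s≤s m≤n)   = +-monoʳ-≤ 1# (ι-mono-≤ m≤n)

  x<1+x : ∀ x → x < 1# + x
  x<1+x x = ≰⇒> λ 1+x≤x → 0≢1 (≤-antisym 0≤1 (rearrange (solve 2 (λ o x → o :+ x := con (ℤ.+ 0) :+ (o :+ x)) refl 1# x) 1+x≤x))

  ι-mono-< : ∀ {m n} → m ℕ.< n → ι m < ι n
  ι-mono-< {m} m<n = <-≤-trans (x<1+x (ι m)) (ι-mono-≤ m<n)

  ι-cancel-≤ : ∀ {m n} → ι m ≤ ι n → m ℕ.≤ n
  ι-cancel-≤ {m} {n} ιm≤ιn with m ℕ.≤? n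
  ... | yes m≤n = m≤n
  ... | no m≰n  = ⊥-elim (<⇒≱ (ι-mono-< (ℕ.≰⇒> m≰n)) ιm≤ιn)

  private
    1+1≢0 : 1# + 1# ≢ 0#
    1+1≢0 eq = <⇒≱ (x<1+x 1#) (≤-trans (≤-reflexive eq) 0≤1)

    ½ : ℝ
    ½ = proj₁ (inverse (1# + 1#) 1+1≢0)

    halves : ∀ x → x * ½ + x * ½ ≡ x
    halves x = trans (sym (distribˡ x ½ ½)) (trans (cong (x *_) (trans (cong₂ _+_ (sym (*-identityˡ ½)) (sym (*-identityˡ ½)))
      (trans (sym (distribʳ ½ 1# 1#)) (proj₂ (inverse (1# + 1#) 1+1≢0))))) (*-identityʳ x))

  -- The witness is the midpoint: since `z + z ≡ x + y`, either of `z ≤ x` and `y ≤ z` would give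
  -- `y ≤ x`.
  dense : ∀ {x y} → x < y → ∃[ z ] x < z × z < y
  dense {x} {y} x<y = z , ≰⇒> (λ z≤x → <⇒≱ x<y (y≤x z≤x)) , ≰⇒> (λ y≤z → <⇒≱ x<y (y≤x′ y≤z))
    where
    z = (x + y) * ½
    z+z : z + z ≡ x + y
    z+z = halves (x + y)
    y≤x : z ≤ x → y ≤ x
    y≤x z≤x = rearrange (trans (solve 2 (λ x y → y :+ (x :+ x) := x :+ (x :+ y)) refl x y) (cong (x +_) (sym z+z))) (+-mono-≤ z≤x z≤x)
    y≤x′ : y ≤ z → y ≤ x
    y≤x′ y≤z = rearrange (trans (cong (y +_) z+z) (solve 2 (λ x y → y :+ (x :+ y) := x :+ (y :+ y)) refl x y)) (+-mono-≤ y≤z y≤z)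

  -- A number strictly between `y` and `x` would contradict the hypothesis. This takes the place of
  -- ε-arguments about infima of covers.
  ≤-approx : ∀ {x y} → (∀ {z} → y < z → x ≤ z) → x ≤ y
  ≤-approx {x} {y} h = ≮⇒≥ λ y<x → let z , y<z , z<x = dense y<x in <⇒≱ z<x (h y<z)

  -- Completeness is stated for predicates in `Set₁`, so a small predicate is lifted there first.
  sup : (P : Pred ℝ 0ℓ) → ∃ P → ∃ (IsUpperBound P) → ∃ (IsSup P)
  sup P (x , Px) (u , P≤u) with complete (Lift (lsuc 0ℓ) ∘ P) (x , lift Px) (u , λ y Py → P≤u y (Level.lower Py))
  ... | s , P≤s , least = s , (λ y Py → P≤s y (lift Py)) , λ v P≤v → least v λ y Py → P≤v y (Level.lower Py)

-- Finite sums and interleaved sequences.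

total : ℕ → (ℕ → ℕ) → ℕ
total zero    f = 0
total (suc n) f = total n f ℕ.+ f n

module FiniteSums (R : RealNumbers) where
  open RealNumbers R
  open Lebesgue R
  open OrderedField R

  ∑-cong : ∀ n {f g : ℕ → ℝ} → (∀ k → f k ≡ g k) → ∑< n f ≡ ∑< n g
  ∑-cong zero    f≡g = refl
  ∑-cong (suc n) f≡g = cong₂ _+_ (∑-cong n f≡g) (f≡g n)

  ∑-mono-≤ : ∀ n {f g : ℕ → ℝ} → (∀ k → k ℕ.< n → f k ≤ g k) → ∑< n f ≤ ∑< n g
  ∑-mono-≤ zero    f≤g = ≤-refl
  ∑-mono-≤ (suc n) f≤g = +-mono-≤ (∑-mono-≤ n λ k k<n → f≤g k (ℕ.m<n⇒m<1+n k<n)) (f≤g n (ℕ.n<1+n n))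

  ∑-distrib-+ : ∀ n (f g : ℕ → ℝ) → ∑< n (λ k → f k + g k) ≡ ∑< n f + ∑< n g
  ∑-distrib-+ zero    f g = sym (+-identityʳ 0#)
  ∑-distrib-+ (suc n) f g = trans (cong (_+ (f n + g n)) (∑-distrib-+ n f g))
    (solve 4 (λ a b c d → (a :+ b) :+ (c :+ d) := (a :+ c) :+ (b :+ d)) refl (∑< n f) (∑< n g) (f n) (g n))

  *-distribˡ-∑ : ∀ c n (f : ℕ → ℝ) → c * ∑< n f ≡ ∑< n (λ k → c * f k)
  *-distribˡ-∑ c zero    f = zeroʳ c
  *-distribˡ-∑ c (suc n) f = trans (distribˡ c (∑< n f) (f n)) (cong (_+ c * f n) (*-distribˡ-∑ c n f))

  ∑-zero : ∀ n → ∑< n (λ _ → 0#) ≡ 0#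
  ∑-zero zero    = refl
  ∑-zero (suc n) = trans (+-identityʳ _) (∑-zero n)

  ∑-nonNeg : ∀ n {f : ℕ → ℝ} → (∀ k → 0# ≤ f k) → 0# ≤ ∑< n f
  ∑-nonNeg n 0≤f = ≤-trans (≤-reflexive (sym (∑-zero n))) (∑-mono-≤ n λ k _ → 0≤f k)

  ∑-monoˡ-≤ : ∀ {m n} {f : ℕ → ℝ} → (∀ k → 0# ≤ f k) → m ℕ.≤ n → ∑< m f ≤ ∑< n f
  ∑-monoˡ-≤ {m} {f = f} 0≤f m≤n = go (ℕ.≤⇒≤′ m≤n)
    where
    go : ∀ {n} → m ℕ.≤′ n → ∑< m f ≤ ∑< n f
    go (ℕ.≤′-reflexive refl) = ≤-refl
    go (ℕ.≤′-step m≤n)       = ≤-trans (go m≤n) (x≤x+y (0≤f _))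

  term≤∑ : ∀ {k n} {f : ℕ → ℝ} → (∀ k → 0# ≤ f k) → k ℕ.< n → f k ≤ ∑< n f
  term≤∑ {k} {f = f} 0≤f k<n = ≤-trans (≤-trans (x≤x+y (∑-nonNeg k 0≤f)) (≤-reflexive (+-comm (f k) _))) (∑-monoˡ-≤ 0≤f k<n)

  ∑-unfoldˡ : ∀ n (f : ℕ → ℝ) → ∑< (suc n) f ≡ f 0 + ∑< n (f ∘ suc)
  ∑-unfoldˡ zero    f = trans (+-identityˡ _) (sym (+-identityʳ _))
  ∑-unfoldˡ (suc n) f = trans (cong (_+ f (suc n)) (∑-unfoldˡ n f)) (+-assoc (f 0) _ _)

  -- Sums of integer data are moved into ℕ, where evaluation decides the final inequalities.
  ι-total : ∀ n f → ι (total n f) ≡ ∑< n (ι ∘ f)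
  ι-total zero    f = refl
  ι-total (suc n) f = trans (ι-+ (total n f) (f n)) (cong (_+ ι (f n)) (ι-total n f))

  ∑-comm : ∀ m n (f : ℕ → ℕ → ℝ) → ∑< m (λ i → ∑< n (f i)) ≡ ∑< n (λ j → ∑< m (λ i → f i j))
  ∑-comm zero    n f = sym (∑-zero n)
  ∑-comm (suc m) n f = trans (cong (_+ ∑< n (f m)) (∑-comm m n f)) (sym (∑-distrib-+ n _ (f m)))

  -- The sequence f 0, g 0, f 1, g 1, ..., which merges two covers into one. Exchanging the
  -- arguments at each index avoids a case distinction on parity.
  interleave : (f g : ℕ → ℝ) → ℕ → ℝ
  interleave f g zero    = f 0
  interleave f g (suc n) = interleave g (f ∘ suc) n

  interleave-even : ∀ f g n → interleave f g (n ℕ.* 2) ≡ f n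
  interleave-even f g zero    = refl
  interleave-even f g (suc n) = interleave-even (f ∘ suc) (g ∘ suc) n

  interleave-odd : ∀ f g n → interleave f g (suc (n ℕ.* 2)) ≡ g n
  interleave-odd f g n = interleave-even g (f ∘ suc) n

  interleave-all : ∀ {f f′ g g′ : ℕ → ℝ} (_~_ : ℝ → ℝ → Set) →
    (∀ n → f n ~ f′ n) → (∀ n → g n ~ g′ n) → ∀ n → interleave f g n ~ interleave f′ g′ n
  interleave-all _~_ f~f′ g~g′ zero    = f~f′ 0
  interleave-all _~_ f~f′ g~g′ (suc n) = interleave-all _~_ g~g′ (f~f′ ∘ suc) n

  interleave-- : ∀ f f′ g g′ n → interleave f g n - interleave f′ g′ n ≡ interleave (λ n → f n - f′ n) (λ n → g n - g′ n) n
  interleave-- f f′ g g′ zero    = refl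
  interleave-- f f′ g g′ (suc n) = interleave-- g g′ (f ∘ suc) (f′ ∘ suc) n

  -- The first n terms of the interleaving are found among the first n terms of each sequence. This
  -- generous count is harmless because the total of a cover bounds all partial sums at once.
  ∑-interleave-≤ : ∀ n {f g : ℕ → ℝ} → (∀ k → 0# ≤ f k) → (∀ k → 0# ≤ g k) → ∑< n (interleave f g) ≤ ∑< n f + ∑< n g
  ∑-interleave-≤ zero    0≤f 0≤g = ≤-reflexive (sym (+-identityʳ 0#))
  ∑-interleave-≤ (suc n) {f} {g} 0≤f 0≤g = begin
    ∑< (suc n) (interleave f g)                ≡⟨ ∑-unfoldˡ n (interleave f g) ⟩
    f 0 + ∑< n (interleave g (f ∘ suc))        ≤⟨ +-monoʳ-≤ (f 0) (∑-interleave-≤ n 0≤g (0≤f ∘ suc)) ⟩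
    f 0 + (∑< n g + ∑< n (f ∘ suc))
      ≡⟨ solve 3 (λ a b c → a :+ (b :+ c) := (a :+ c) :+ b) refl (f 0) (∑< n g) (∑< n (f ∘ suc)) ⟩
    (f 0 + ∑< n (f ∘ suc)) + ∑< n g            ≡⟨ cong (_+ ∑< n g) (sym (∑-unfoldˡ n f)) ⟩
    ∑< (suc n) f + ∑< n g                      ≤⟨ +-monoʳ-≤ (∑< (suc n) f) (∑-monoˡ-≤ 0≤g (ℕ.n≤1+n n)) ⟩
    ∑< (suc n) f + ∑< (suc n) g                ∎
    where open ≤-Reasoning

-- Outer measure and Carathéodory measurability.

module OuterMeasures (R : RealNumbers) where
  open RealNumbers R
  open Lebesgue R
  open OrderedField R
  open FiniteSums R

  Cover-⊆ : ∀ {A B T} → (∀ t → t ∈ A → t ∈ B) → Cover B T → Cover A T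
  Cover-⊆ A⊆B c = record { Cover c ; covers = λ t t∈A → Cover.covers c t (A⊆B t t∈A) }

  Cover-nonNeg : ∀ {A T} → Cover A T → 0# ≤ T
  Cover-nonNeg c = Cover.sum≤total c 0

  Cover-∪ : ∀ {A B C S T} → (∀ t → t ∈ C → t ∈ A ⊎ t ∈ B) → Cover A S → Cover B T → Cover C (S + T)
  Cover-∪ {A} {B} {C} {S} {T} C⊆A∪B c d = record
    { left       = interleave c.left d.left
    ; right      = interleave c.right d.right
    ; left≤right = interleave-all _≤_ c.left≤right d.left≤right
    ; covers     = covers
    ; sum≤total  = λ N → begin
        ∑< N (λ n → interleave c.right d.right n - interleave c.left d.left n)
          ≡⟨ ∑-cong N (interleave-- c.right c.left d.right d.left) ⟩
        ∑< N (interleave (λ n → c.right n - c.left n) (λ n → d.right n - d.left n))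
          ≤⟨ ∑-interleave-≤ N (x≤y⇒0≤y-x ∘ c.left≤right) (x≤y⇒0≤y-x ∘ d.left≤right) ⟩
        ∑< N (λ n → c.right n - c.left n) + ∑< N (λ n → d.right n - d.left n)
          ≤⟨ +-mono-≤ (c.sum≤total N) (d.sum≤total N) ⟩
        S + T                                                                   ∎
    }
    where
    open ≤-Reasoning
    module c = Cover c
    module d = Cover d
    covers : ∀ t → t ∈ C → ∃[ n ] (interleave c.left d.left n < t × t < interleave c.right d.right n)
    covers t t∈C with C⊆A∪B t t∈C
    ... | inj₁ t∈A = let n , l<t , t<r = c.covers t t∈A in
      n ℕ.* 2 , subst (_< t) (sym (interleave-even c.left d.left n)) l<t , subst (t <_) (sym (interleave-even c.right d.right n)) t<r
    ... | inj₂ t∈B = let n , l<t , t<r = d.covers t t∈B in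
      suc (n ℕ.* 2) , subst (_< t) (sym (interleave-odd c.left d.left n)) l<t , subst (t <_) (sym (interleave-odd c.right d.right n)) t<r

  -- A cover is an infinite sequence, so the one interval is followed by empty intervals at `a`.
  Cover-interval : ∀ {a b} → a ≤ b → Cover (λ t → a < t × t < b) (b - a)
  Cover-interval {a} {b} a≤b = record
    { left = λ _ → a ; right = right
    ; left≤right = λ { zero → a≤b ; (suc n) → ≤-refl }
    ; covers = λ t t∈ → 0 , t∈
    ; sum≤total = λ { zero → x≤y⇒0≤y-x a≤b ; (suc N) → ≤-reflexive (sum N) } }
    where
    right : ℕ → ℝ
    right zero    = b
    right (suc _) = a
    sum : ∀ N → ∑< (suc N) (λ n → right n - a) ≡ b - a
    sum zero    = +-identityˡ _
    sum (suc N) = trans (cong₂ _+_ (sum N) (-‿inverseʳ a)) (+-identityʳ _)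

  OuterMeasure-mono : ∀ {A B m n} → (∀ t → t ∈ A → t ∈ B) → OuterMeasure A m → OuterMeasure B n → m ≤ n
  OuterMeasure-mono A⊆B (m≤ , _) (_ , greatest) = greatest _ λ T c → m≤ T (Cover-⊆ A⊆B c)

  OuterMeasure-resp : ∀ {A B m} → (∀ t → t ∈ A → t ∈ B) → (∀ t → t ∈ B → t ∈ A) → OuterMeasure A m → OuterMeasure B m
  OuterMeasure-resp A⊆B B⊆A (m≤ , greatest) = (λ T c → m≤ T (Cover-⊆ A⊆B c)) , λ l l≤ → greatest l λ T c → l≤ T (Cover-⊆ B⊆A c)

  OuterMeasure-nonNeg : ∀ {A m} → OuterMeasure A m → 0# ≤ m
  OuterMeasure-nonNeg (_ , greatest) = greatest 0# λ T → Cover-nonNeg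

  -- The infimum of the totals of covers is the supremum of their lower bounds. These are bounded
  -- above by `m`, because every cover of X also covers A.
  OuterMeasure-exists : ∀ {A X m} → (∀ t → t ∈ A → t ∈ X) → OuterMeasure X m → ∃ (OuterMeasure A)
  OuterMeasure-exists {A} {X} {m} A⊆X (_ , greatest)
    with sup (IsLowerBound (Cover A)) (0# , λ T → Cover-nonNeg) (m , λ l l≤ → greatest l λ T c → l≤ T (Cover-⊆ A⊆X c))
  ... | i , lower≤i , least = i , (λ T c → least T λ l l≤ → l≤ T c) , lower≤i

  -- Instead of choosing nearly optimal covers, the greatest lower bound property is applied twice:
  -- `o - T` bounds the covers of A below for each cover of B with total T, hence `o - m` bounds the
  -- covers of B below.
  OuterMeasure-∪-≤ : ∀ {A B C m n o} → (∀ t → t ∈ C → t ∈ A ⊎ t ∈ B) →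
    OuterMeasure A m → OuterMeasure B n → OuterMeasure C o → o ≤ m + n
  OuterMeasure-∪-≤ {m = m} {n} {o} C⊆A∪B (_ , greatestA) (_ , greatestB) (o≤ , _) =
    rearrange (solve 3 (λ o m n → o :+ n := (m :+ n) :+ (o :- m)) refl o m n) (greatestB (o - m) λ T d →
      rearrange (solve 3 (λ o m T → (o :- m) :+ m := T :+ (o :- T)) refl o m T) (greatestA (o - T) λ S c →
        rearrange (solve 3 (λ o T S → (o :- T) :+ (S :+ T) := S :+ o) refl o T S) (o≤ (S + T) (Cover-∪ C⊆A∪B c d))))

  OuterMeasure-empty : ∀ {A m} → (∀ t → ¬ t ∈ A) → OuterMeasure A m → m ≡ 0#
  OuterMeasure-empty A≡∅ om@(m≤ , _) = ≤-antisym (m≤ 0# (Cover-⊆ (λ t t∈A → ⊥-elim (A≡∅ t t∈A)) cover)) (OuterMeasure-nonNeg om)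
    where
    cover : Cover (λ t → 0# < t × t < 0#) 0#
    cover = subst (Cover _) (-‿inverseʳ 0#) (Cover-interval ≤-refl)

  Measurable-resp : ∀ {E F} → (∀ t → t ∈ E → t ∈ F) → (∀ t → t ∈ F → t ∈ E) → Measurable E → Measurable F
  Measurable-resp E⊆F F⊆E mE A om om₁ om₂ = mE A om
    (OuterMeasure-resp (λ { t (a , f) → a , F⊆E t f }) (λ { t (a , e) → a , E⊆F t e }) om₁)
    (OuterMeasure-resp (λ { t (a , ¬f) → a , ¬f ∘ E⊆F t }) (λ { t (a , ¬e) → a , ¬e ∘ F⊆E t }) om₂)

  -- The criterion is symmetric in E and its complement up to a double negation, which decidability
  -- removes.
  Measurable-∁ : ∀ {E} → Decidable E → Measurable E → Measurable (∁ E)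
  Measurable-∁ E? mE A om om₁ om₂ = trans
    (mE A om (OuterMeasure-resp (λ { t (a , ¬¬e) → a , stable t ¬¬e }) (λ { t (a , e) → a , λ ¬e → ¬e e }) om₂) om₁)
    (+-comm _ _)
    where
    stable : ∀ t → ¬ ¬ _ → _
    stable t ¬¬e with E? t
    ... | yes e = e
    ... | no ¬e = ⊥-elim (¬¬e ¬e)

  -- The test set is split by E, and its part inside E by F. The two pieces outside E ∩ F are
  -- exactly those into which E splits the remainder of the test set.
  Measurable-∩ : ∀ {E F} → Measurable E → Measurable F → Measurable (E ∩ F)
  Measurable-∩ {E} {F} mE mF A {m} {m₁} {m₂} om om₁ om₂ = begin
    m                  ≡⟨ mE A om oE o∁E ⟩
    mE′ + m∁E
      ≡⟨ cong (_+ m∁E) (mF (A ∩ E) oE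
        (OuterMeasure-resp (λ { t (a , e , f) → (a , e) , f }) (λ { t ((a , e) , f) → a , e , f }) om₁) oE∁F) ⟩
    (m₁ + mE∁F) + m∁E  ≡⟨ +-assoc m₁ mE∁F m∁E ⟩
    m₁ + (mE∁F + m∁E)  ≡⟨ cong (m₁ +_) (sym (mE (A ∩ ∁ (E ∩ F)) om₂
      (OuterMeasure-resp (λ { t ((a , e) , ¬f) → (a , λ (_ , f) → ¬f f) , e })
                         (λ { t ((a , ¬ef) , e) → (a , e) , λ f → ¬ef (e , f) }) oE∁F)
      (OuterMeasure-resp (λ { t (a , ¬e) → (a , λ (e , _) → ¬e e) , ¬e }) (λ { t ((a , _) , ¬e) → a , ¬e }) o∁E))) ⟩
    m₁ + m₂            ∎
    where
    open ≡-Reasoning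
    eE = OuterMeasure-exists {A ∩ E} (λ t → proj₁) om
    e∁E = OuterMeasure-exists {A ∩ ∁ E} (λ t → proj₁) om
    mE′ = proj₁ eE ; oE = proj₂ eE ; m∁E = proj₁ e∁E ; o∁E = proj₂ e∁E
    eE∁F = OuterMeasure-exists {(A ∩ E) ∩ ∁ F} (λ t → proj₁) oE
    mE∁F = proj₁ eE∁F ; oE∁F = proj₂ eE∁F

-- Outer measure and measurability of intervals.

module Intervals (R : RealNumbers) where
  open RealNumbers R
  open Lebesgue R
  open OrderedField R
  open FiniteSums R
  open OuterMeasures R

  private
    totalOrder : TotalOrder 0ℓ 0ℓ 0ℓ
    totalOrder = DecTotalOrder.totalOrder (record { isDecTotalOrder = isDecTotalOrder })

  open Min totalOrder using (_⊓_; x≤y⇒x⊓y≈x; x≤y⇒y⊓x≈x; ⊓-monoˡ-≤; x⊓y≤x; x⊓y≤y; ⊓-glb; ⊓-sel)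
  open Max totalOrder using (_⊔_; x≤y⇒x⊔y≈y; x≤y⇒y⊔x≈y; ⊔-monoˡ-≤; x≤x⊔y; x≤y⊔x; ⊔-sel)

  ⊓+⊔ : ∀ x y → (x ⊓ y) + (x ⊔ y) ≡ x + y
  ⊓+⊔ x y = [ (λ x≤y → cong₂ _+_ (x≤y⇒x⊓y≈x x≤y) (x≤y⇒x⊔y≈y x≤y))
            , (λ y≤x → trans (cong₂ _+_ (x≤y⇒y⊓x≈x y≤x) (x≤y⇒y⊔x≈y y≤x)) (+-comm y x)) ]′ (≤-total x y)

  <-⊓ : ∀ {t x y} → t < x → t < y → t < x ⊓ y
  <-⊓ {t} {x} {y} t<x t<y = [ (λ eq → subst (t <_) (sym eq) t<x) , (λ eq → subst (t <_) (sym eq) t<y) ]′ (⊓-sel x y)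

  ⊔-< : ∀ {t x y} → x < t → y < t → x ⊔ y < t
  ⊔-< {t} {x} {y} x<t y<t = [ (λ eq → subst (_< t) (sym eq) x<t) , (λ eq → subst (_< t) (sym eq) y<t) ]′ (⊔-sel x y)

  private
    -- For l ≤ r this is the point of [l , r] nearest to x. Its increment from x to y is therefore
    -- the length of [l , r] inside [x , y].
    clamp : ℝ → ℝ → ℝ → ℝ
    clamp l r x = (x ⊔ l) ⊓ r

    clamp-mono : ∀ l r {x y} → x ≤ y → clamp l r x ≤ clamp l r y
    clamp-mono l r x≤y = ⊓-monoˡ-≤ r (⊔-monoˡ-≤ l x≤y)

    clamp-within : ∀ {l r x} → l ≤ x → x ≤ r → clamp l r x ≡ x
    clamp-within {l} {r} {x} l≤x x≤r = trans (cong (_⊓ r) (x≤y⇒y⊔x≈y l≤x)) (x≤y⇒x⊓y≈x x≤r)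

    ≤clamp : ∀ {l r} x → l ≤ r → l ≤ clamp l r x
    ≤clamp x l≤r = ⊓-glb (x≤y⊔x x _) l≤r

    clamp≤ : ∀ l r x → clamp l r x ≤ r
    clamp≤ l r x = x⊓y≤y (x ⊔ l) r

  module _ {A : Subset} {T a b : ℝ} (c : Cover A T) where
    private
      open Cover c

      increments : ℝ → ℝ → ℕ → ℝ
      increments x y n = clamp (left n) (right n) y - clamp (left n) (right n) x

      increments-nonNeg : ∀ {x y} → x ≤ y → ∀ n → 0# ≤ increments x y n
      increments-nonNeg x≤y n = x≤y⇒0≤y-x (clamp-mono (left n) (right n) x≤y)

      Reached : Pred ℝ 0ℓ
      Reached x = a ≤ x × x ≤ b × ∃[ N ] x - a ≤ ∑< N (increments a x)

      -- Between x and y the interval with index n alone contributes the whole length y - x.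
      push : ∀ n {x y} → left n ≤ x → x ≤ y → y ≤ right n → y ≤ b → Reached x → Reached y
      push n {x} {y} lₙ≤x x≤y y≤rₙ y≤b (a≤x , _ , N , x-a≤) = ≤-trans a≤x x≤y , y≤b , M , (begin
        y - a                                             ≡⟨ sym (telescope a x y) ⟩
        (y - x) + (x - a)
          ≤⟨ +-mono-≤ y-x≤ (≤-trans x-a≤ (∑-monoˡ-≤ (increments-nonNeg a≤x) (ℕ.m≤m+n N (suc n)))) ⟩
        ∑< M (increments x y) + ∑< M (increments a x)     ≡⟨ sym (∑-distrib-+ M (increments x y) (increments a x)) ⟩
        ∑< M (λ k → increments x y k + increments a x k)
          ≡⟨ ∑-cong M (λ k → telescope (clamp (left k) (right k) a) (clamp (left k) (right k) x)
               (clamp (left k) (right k) y)) ⟩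
        ∑< M (increments a y)                             ∎)
        where
        open ≤-Reasoning
        -- Enough indices for both the N intervals used so far and the interval n.
        M = N ℕ.+ suc n
        y-x≤ : y - x ≤ ∑< M (increments x y)
        y-x≤ = ≤-trans (≤-reflexive (sym (cong₂ _-_ (clamp-within (≤-trans lₙ≤x x≤y) y≤rₙ) (clamp-within lₙ≤x (≤-trans x≤y y≤rₙ)))))
          (term≤∑ {k = n} {f = increments x y} (increments-nonNeg x≤y) (ℕ.m≤n+m (suc n) N))

      b-reached⇒ : Reached b → b - a ≤ T
      b-reached⇒ (_ , _ , N , b-a≤) = ≤-trans b-a≤ (≤-trans (∑-mono-≤ N λ k _ →
        +-mono-≤ (clamp≤ (left k) (right k) b) (-‿anti-mono (≤clamp a (left≤right k)))) (sum≤total N))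

      -- A reached point to the right of `left n` could be pushed inside interval n to b or to a
      -- point beyond s.
      reached≤left : ∀ {s n} → IsSup Reached s → s < right n → ¬ Reached b → ∀ x → Reached x → x ≤ left n
      reached≤left {s} {n} (reached≤s , _) s<rₙ ¬b-reached x x-reached with x ≤? left n
      ... | yes x≤lₙ = x≤lₙ
      ... | no x≰lₙ = ⊥-elim (beyond (dense s<rₙ))
        where
        lₙ≤x = <⇒≤ (≰⇒> x≰lₙ)
        beyond : ¬ (∃[ y ] s < y × y < right n)
        beyond (y , s<y , y<rₙ) with b ≤? y
        ... | yes b≤y = ¬b-reached (push n lₙ≤x (proj₁ (proj₂ x-reached)) (≤-trans b≤y (<⇒≤ y<rₙ)) ≤-refl x-reached)
        ... | no b≰y  = <⇒≱ s<y (reached≤s y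
          (push n lₙ≤x (≤-trans (reached≤s x x-reached) (<⇒≤ s<y)) (<⇒≤ y<rₙ) (<⇒≤ (≰⇒> b≰y)) x-reached))

    -- Heine–Borel by a supremum: let s be the supremum of the x such that
    -- finitely many of the covering intervals have total length at least x - a
    -- inside [a , x].  The interval that contains s reaches beyond s, so s is b.
    Cover-closed-≥ : (∀ t → a ≤ t → t ≤ b → t ∈ A) → a ≤ b → b - a ≤ T
    Cover-closed-≥ [a,b]⊆A a≤b with b - a ≤? T
    ... | yes b-a≤T = b-a≤T
    ... | no b-a≰T  = ⊥-elim (stuck (sup Reached (a , a-reached) (b , λ x → proj₁ ∘ proj₂)))
      where
      a-reached : Reached a
      a-reached = ≤-refl , a≤b , 0 , ≤-reflexive (-‿inverseʳ a)
      stuck : ¬ ∃ (IsSup Reached)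
      stuck (s , s-sup@(reached≤s , s-least)) =
        let n , lₙ<s , s<rₙ = covers s ([a,b]⊆A s (reached≤s a a-reached) (s-least b λ x → proj₁ ∘ proj₂)) in
        <⇒≱ lₙ<s (s-least (left n) (reached≤left {n = n} s-sup s<rₙ (b-a≰T ∘ b-reached⇒)))

  ⟨_,_] : ℝ → ℝ → Subset
  ⟨ a , b ] t = a < t × t ≤ b

  -- A cover with total T < b - a would cover some closed interval [x , b] with x strictly between a
  -- and b - T, which is longer than T. Conversely, an open interval from a of any length above b -
  -- a is a cover.
  OuterMeasure-interval : ∀ {a b} → a ≤ b → OuterMeasure ⟨ a , b ] (b - a)
  OuterMeasure-interval {a} {b} a≤b = lower , λ l l≤ → ≤-approx λ {T} b-a<T → l≤ T (cover b-a<T)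
    where
    lower : ∀ T → Cover ⟨ a , b ] T → b - a ≤ T
    lower T c = ≮⇒≥ λ T<b-a →
      let x , a<x , x<b-T = dense (a<b-T T<b-a) in
      <⇒≱ x<b-T (rearrange (solve 3 (λ b T x → (b :- T) :+ T := x :+ (b :- x)) refl b T x)
        (Cover-closed-≥ c (λ t x≤t t≤b → <-≤-trans a<x x≤t , t≤b) (<⇒≤ (<-≤-trans x<b-T b-T≤b))))
      where
      a<b-T : T < b - a → a < b - T
      a<b-T T<b-a = ≰⇒> λ b-T≤a → <⇒≱ T<b-a (rearrange (solve 3 (λ a b T → (b :- a) :+ a := T :+ (b :- T)) refl a b T) b-T≤a)
      b-T≤b : b - T ≤ b
      b-T≤b = rearrange (solve 2 (λ b T → (b :- T) :+ T := b :+ con (ℤ.+ 0)) refl b T) (Cover-nonNeg c)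
    cover : ∀ {T} → b - a < T → Cover ⟨ a , b ] T
    cover {T} b-a<T = subst (Cover _) (solve 2 (λ a T → (a :+ T) :- a := T) refl a T)
      (Cover-⊆ (λ t (a<t , t≤b) → a<t , ≤-<-trans t≤b b<a+T) (Cover-interval (≤-trans a≤b (<⇒≤ b<a+T))))
      where
      b<a+T : b < a + T
      b<a+T = ≰⇒> λ a+T≤b → <⇒≱ b-a<T (rearrange (solve 3 (λ a b T → T :+ b := (b :- a) :+ (a :+ T)) refl a b T) a+T≤b)

  Cover-point : ∀ b {ε} → 0# < ε → Cover (_≡ b) ε
  Cover-point b {ε} 0<ε = around (dense 0<ε)
    where
    around : ∃[ δ ] 0# < δ × δ < ε → Cover (_≡ b) ε
    -- The interval from b - δ to b + ε - δ contains b and has length exactly ε.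
    around (δ , 0<δ , δ<ε) = subst (Cover _) (solve 3 (λ b δ ε → ((b :+ ε) :- δ) :- (b :- δ) := ε) refl b δ ε)
      (Cover-⊆ within (Cover-interval b-δ≤b+ε-δ))
      where
      within : ∀ t → t ≡ b → b - δ < t × t < (b + ε) - δ
      within t refl =
        ≰⇒> (λ b≤b-δ → <⇒≱ 0<δ (rearrange (solve 2 (λ b δ → δ :+ (b :- δ) := con (ℤ.+ 0) :+ b) refl b δ) b≤b-δ)) ,
        ≰⇒> (λ b+ε-δ≤b → <⇒≱ δ<ε (rearrange (solve 3 (λ b δ ε → ε :+ b := δ :+ ((b :+ ε) :- δ)) refl b δ ε) b+ε-δ≤b))
      b-δ≤b+ε-δ : b - δ ≤ (b + ε) - δ
      b-δ≤b+ε-δ = rearrange (solve 3 (λ b δ ε → (b :- δ) :+ ε := ((b :+ ε) :- δ) :+ con (ℤ.+ 0)) refl b δ ε) (<⇒≤ 0<ε)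

  module _ {A : Subset} {T : ℝ} (b : ℝ) (c : Cover A T) where
    private
      open Cover c
      lower upper : ℕ → ℝ
      lower n = (right n ⊓ b) - (left n ⊓ b)
      upper n = (right n ⊔ b) - (left n ⊔ b)

      lower-nonNeg : ∀ n → 0# ≤ lower n
      lower-nonNeg n = x≤y⇒0≤y-x (⊓-monoˡ-≤ b (left≤right n))

      upper-nonNeg : ∀ n → 0# ≤ upper n
      upper-nonNeg n = x≤y⇒0≤y-x (⊔-monoˡ-≤ b (left≤right n))

      lower+upper : ∀ n → lower n + upper n ≡ right n - left n
      lower+upper n = trans (exchange (right n ⊓ b) (left n ⊓ b) (right n ⊔ b) (left n ⊔ b))
        (trans (cong₂ _-_ (⊓+⊔ (right n) b) (⊓+⊔ (left n) b)) (cancel (right n) (left n) b))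
        where
        exchange : ∀ p q r s → (p - q) + (r - s) ≡ (p + r) - (q + s)
        exchange = solve 4 (λ p q r s → (p :- q) :+ (r :- s) := (p :+ r) :- (q :+ s)) refl
        cancel : ∀ x y z → (x + z) - (y + z) ≡ x - y
        cancel = solve 3 (λ x y z → (x :+ z) :- (y :+ z) := x :- y) refl

      lower+upper≤T : ∀ M N → ∑< M lower + ∑< N upper ≤ T
      lower+upper≤T M N = begin
        ∑< M lower + ∑< N upper
          ≤⟨ +-mono-≤ (∑-monoˡ-≤ lower-nonNeg (ℕ.m≤m+n M N)) (∑-monoˡ-≤ upper-nonNeg (ℕ.m≤n+m N M)) ⟩
        ∑< (M ℕ.+ N) lower + ∑< (M ℕ.+ N) upper  ≡⟨ sym (∑-distrib-+ (M ℕ.+ N) lower upper) ⟩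
        ∑< (M ℕ.+ N) (λ n → lower n + upper n)   ≡⟨ ∑-cong (M ℕ.+ N) lower+upper ⟩
        ∑< (M ℕ.+ N) (λ n → right n - left n)    ≤⟨ sum≤total (M ℕ.+ N) ⟩
        T                                        ∎
        where open ≤-Reasoning

      PartialSum : Pred ℝ 0ℓ
      PartialSum x = ∃[ N ] x ≡ ∑< N lower

      below : ∀ {s} → IsSup PartialSum s → Cover (A ∩ (_< b)) s
      below (sums≤s , _) = record
        { left = λ n → left n ⊓ b ; right = λ n → right n ⊓ b
        ; left≤right = λ n → ⊓-monoˡ-≤ b (left≤right n)
        ; covers = λ t (t∈A , t<b) → let n , l<t , t<r = covers t t∈A in
            n , ≤-<-trans (x⊓y≤x (left n) b) l<t , <-⊓ t<r t<b
        ; sum≤total = λ N → sums≤s _ (N , refl) }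

      above : ∀ {s} → IsSup PartialSum s → Cover (A ∩ ∁ (_≤ b)) (T - s)
      above {s} (_ , s-least) = record
        { left = λ n → left n ⊔ b ; right = λ n → right n ⊔ b
        ; left≤right = λ n → ⊔-monoˡ-≤ b (left≤right n)
        ; covers = λ t (t∈A , t≰b) → let n , l<t , t<r = covers t t∈A in
            n , ⊔-< l<t (≰⇒> t≰b) , <-≤-trans t<r (x≤x⊔y (right n) b)
        ; sum≤total = λ N → swap (s-least (T - ∑< N upper) λ { x (M , refl) → unswap (lower+upper≤T M N) }) }
        where
        swap : ∀ {u} → s ≤ T - u → u ≤ T - s
        swap {u} = rearrange (solve 3 (λ T s u → u :+ (T :- u) := (T :- s) :+ s) refl T s u)
        unswap : ∀ {l u} → l + u ≤ T → l ≤ T - u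
        unswap {l} {u} = rearrange (solve 3 (λ T l u → l :+ T := (T :- u) :+ (l :+ u)) refl T l u)

    -- Every interval is cut at b, and its two lengths add up to the old one. With `s` the supremum
    -- of the partial sums on the left, T - s bounds every partial sum on the right. The open pieces
    -- leave out b itself.
    Cover-split : ∃[ s ] Cover (A ∩ (_< b)) s × Cover (A ∩ ∁ (_≤ b)) (T - s)
    Cover-split = let s , s-sup = sup PartialSum (0# , 0 , refl) (T , λ { x (N , refl) → ≤-trans (x≤x+y ≤-refl) (lower+upper≤T N 0) })
                  in s , below s-sup , above s-sup

  -- A cover of the test set is cut at b. The slack T′ - T pays for an interval around b, the only
  -- point that the two halves miss.
  Measurable-≤ : ∀ b → Measurable (_≤ b)
  Measurable-≤ b A {_} {m₁} {m₂} om om₁ om₂ = ≤-antisym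
    (OuterMeasure-∪-≤ split om₁ om₂ om)
    (proj₂ om (m₁ + m₂) λ T c → ≤-approx λ T<T′ → halves T<T′ (Cover-split b c))
    where
    split : ∀ t → t ∈ A → t ∈ (A ∩ (_≤ b)) ⊎ t ∈ (A ∩ ∁ (_≤ b))
    split t t∈A with t ≤? b
    ... | yes t≤b = inj₁ (t∈A , t≤b)
    ... | no t≰b  = inj₂ (t∈A , t≰b)

    below∪point : ∀ t → t ∈ (A ∩ (_≤ b)) → t ∈ (A ∩ (_< b)) ⊎ t ≡ b
    below∪point t (t∈A , t≤b) with b ≤? t
    ... | yes b≤t = inj₂ (≤-antisym t≤b b≤t)
    ... | no b≰t  = inj₁ (t∈A , ≰⇒> b≰t)

    halves : ∀ {T T′} → T < T′ → ∃[ s ] Cover (A ∩ (_< b)) s × Cover (A ∩ ∁ (_≤ b)) (T - s) → m₁ + m₂ ≤ T′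
    halves {T} {T′} T<T′ (s , below , above) = ≤-trans
      (+-mono-≤ (proj₁ om₁ _ (Cover-∪ below∪point below (Cover-point b 0<T′-T))) (proj₁ om₂ _ above))
      (≤-reflexive (solve 3 (λ s T T′ → (s :+ (T′ :- T)) :+ (T :- s) := T′) refl s T T′))
      where
      0<T′-T : 0# < T′ - T
      0<T′-T = ≰⇒> λ T′-T≤0 → <⇒≱ T<T′ (rearrange (solve 2 (λ T T′ → T′ :+ con (ℤ.+ 0) := T :+ (T′ :- T)) refl T T′) T′-T≤0)

  Measurable-interval : ∀ a b → Measurable ⟨ a , b ]
  Measurable-interval a b = Measurable-resp (λ t (t≰a , t≤b) → ≰⇒> t≰a , t≤b) (λ t (a<t , t≤b) → <⇒≱ a<t , t≤b)
    (Measurable-∩ (Measurable-∁ (_≤? a) (Measurable-≤ a)) (Measurable-≤ b))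

-- Measure on a grid of unit cells, and upper bounds on integrals.

module Grid (R : RealNumbers) (N : ℕ) where
  open RealNumbers R
  open Lebesgue R
  open OrderedField R
  open FiniteSums R
  open OuterMeasures R
  open Intervals R

  Horizon : Subset
  Horizon = ⟨ 0# , ι N ]

  -- Cells are closed on the right: then the due date d lies in a cell before d,
  -- and at the release r, which lies in the cell before r, the speed is 0.
  cell : ℕ → Subset
  cell k = ⟨ ι k , ι (suc k) ]

  cell-measure : ∀ k → OuterMeasure (cell k) 1#
  cell-measure k = subst (OuterMeasure (cell k)) (solve 2 (λ o x → (o :+ x) :- x := o) refl 1# (ι k))
    (OuterMeasure-interval (ι-mono-≤ (ℕ.n≤1+n k)))

  abstract
    -- Intersecting with the bounded `Horizon` makes outer measure finite, hence a total function on
    -- subsets.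
    μ : Subset → ℝ
    μ A = proj₁ (OuterMeasure-exists {Horizon ∩ A} (λ t → proj₁) (OuterMeasure-interval (0≤ι N)))

    μ-outerMeasure : ∀ A → OuterMeasure (Horizon ∩ A) (μ A)
    μ-outerMeasure A = proj₂ (OuterMeasure-exists {Horizon ∩ A} (λ t → proj₁) (OuterMeasure-interval (0≤ι N)))

  μ-mono : ∀ {A B} → (∀ t → t ∈ Horizon → t ∈ A → t ∈ B) → μ A ≤ μ B
  μ-mono {A} {B} A⊆B = OuterMeasure-mono (λ t (h , a) → h , A⊆B t h a) (μ-outerMeasure A) (μ-outerMeasure B)

  μ-nonNeg : ∀ A → 0# ≤ μ A
  μ-nonNeg A = OuterMeasure-nonNeg (μ-outerMeasure A)

  μ-empty : ∀ {A} → (∀ t → ¬ t ∈ A) → μ A ≡ 0#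
  μ-empty {A} A≡∅ = OuterMeasure-empty (λ t (_ , a) → A≡∅ t a) (μ-outerMeasure A)

  μ-split : ∀ A {E} → Measurable E → μ A ≡ μ (A ∩ E) + μ (A ∩ ∁ E)
  μ-split A {E} mE = mE (Horizon ∩ A) (μ-outerMeasure A)
    (OuterMeasure-resp (λ t (h , a , e) → (h , a) , e) (λ t ((h , a) , e) → h , a , e) (μ-outerMeasure (A ∩ E)))
    (OuterMeasure-resp (λ t (h , a , e) → (h , a) , e) (λ t ((h , a) , e) → h , a , e) (μ-outerMeasure (A ∩ ∁ E)))

  outerMeasure≤μ : ∀ {A m} → (∀ t → t ∈ A → t ∈ Horizon) → OuterMeasure A m → m ≤ μ A
  outerMeasure≤μ {A} A⊆H om = OuterMeasure-mono (λ t a → A⊆H t a , a) om (μ-outerMeasure A)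

  μ-cell≤1 : ∀ k → μ (cell k) ≤ 1#
  μ-cell≤1 k = OuterMeasure-mono (λ t → proj₂) (μ-outerMeasure (cell k)) (cell-measure k)

  μ≤∑cells : ∀ A → μ A ≤ ∑< N (λ k → μ (A ∩ cell k))
  μ≤∑cells A = ≤-trans (μ-mono λ t (_ , t≤N) a → a , t≤N) (upTo N)
    where
    upTo : ∀ n → μ (A ∩ (_≤ ι n)) ≤ ∑< n (λ k → μ (A ∩ cell k))
    -- The horizon excludes 0, so nothing lies before the first cell.
    upTo zero    = ≤-trans (μ-mono {B = λ _ → ⊥} λ t (0<t , _) (_ , t≤0) → <⇒≱ 0<t t≤0) (≤-reflexive (μ-empty λ t ()))
    upTo (suc n) = begin
      μ (A ∩ (_≤ ι (suc n)))
        ≡⟨ μ-split (A ∩ (_≤ ι (suc n))) (Measurable-≤ (ι n)) ⟩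
      μ ((A ∩ (_≤ ι (suc n))) ∩ (_≤ ι n)) + μ ((A ∩ (_≤ ι (suc n))) ∩ ∁ (_≤ ι n))
        ≤⟨ +-mono-≤ (μ-mono λ t _ ((a , _) , t≤n) → a , t≤n) (μ-mono λ t _ ((a , t≤1+n) , t≰n) → a , ≰⇒> t≰n , t≤1+n) ⟩
      μ (A ∩ (_≤ ι n)) + μ (A ∩ cell n)                                                    ≤⟨ +-monoˡ-≤ _ (upTo n) ⟩
      ∑< n (λ k → μ (A ∩ cell k)) + μ (A ∩ cell n)                                         ∎
      where open ≤-Reasoning

  -- Carathéodory's criterion for `F n` splits A. The earlier sets are disjoint from `F n`, so they
  -- meet A only in the part to which the induction hypothesis applies.
  ∑-μ-disjoint-≤ : ∀ n (F : ℕ → Subset) → (∀ j → Measurable (F j)) → (∀ i j → i ≢ j → Disjoint (F i) (F j)) →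
    ∀ A → ∑< n (λ j → μ (A ∩ F j)) ≤ μ A
  ∑-μ-disjoint-≤ zero    F mF disjoint A = μ-nonNeg A
  ∑-μ-disjoint-≤ (suc n) F mF disjoint A = begin
    ∑< n (λ j → μ (A ∩ F j)) + μ (A ∩ F n)
      ≤⟨ +-monoˡ-≤ _ (∑-mono-≤ n λ j j<n → μ-mono λ t _ (a , fj) → (a , λ fn → disjoint j n (ℕ.<⇒≢ j<n) t (fj , fn)) , fj) ⟩
    ∑< n (λ j → μ ((A ∩ ∁ (F n)) ∩ F j)) + μ (A ∩ F n)
      ≤⟨ +-monoˡ-≤ _ (∑-μ-disjoint-≤ n F mF disjoint (A ∩ ∁ (F n))) ⟩
    μ (A ∩ ∁ (F n)) + μ (A ∩ F n)                        ≡⟨ +-comm _ _ ⟩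
    μ (A ∩ F n) + μ (A ∩ ∁ (F n))                        ≡⟨ sym (μ-split A (mF n)) ⟩
    μ A                                                  ∎
    where open ≤-Reasoning

  module _ {f : ℝ → ℝ} {S : Subset} (u : ℕ → ℝ) (0≤u : ∀ k → 0# ≤ u k)
           (S⊆Horizon : ∀ t → t ∈ S → t ∈ Horizon) (f≤u : ∀ k t → t ∈ S → t ∈ cell k → f t ≤ u k) where
    open Piece

    private
      piece≤ : ∀ (p : Piece f S) → height p * size p ≤ ∑< N (λ k → u k * μ (part p ∩ cell k))
      piece≤ p = begin
        height p * size p
          ≤⟨ *-monoʳ-≤-nonNeg (0≤height p)
               (≤-trans (outerMeasure≤μ (λ t t∈p → S⊆Horizon t (part⊆S p t∈p)) (measure p)) (μ≤∑cells (part p))) ⟩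
        height p * ∑< N (λ k → μ (part p ∩ cell k))         ≡⟨ *-distribˡ-∑ (height p) N _ ⟩
        ∑< N (λ k → height p * μ (part p ∩ cell k))         ≤⟨ ∑-mono-≤ N (λ k _ → cell≤ k) ⟩
        ∑< N (λ k → u k * μ (part p ∩ cell k))              ∎
        where
        open ≤-Reasoning
        cell≤ : ∀ k → height p * μ (part p ∩ cell k) ≤ u k * μ (part p ∩ cell k)
        cell≤ k with height p ≤? u k
        ... | yes h≤u = *-monoˡ-≤-nonNeg (μ-nonNeg _) h≤u
        -- A height above `u k` means that the part misses cell k, where f is at most `u k` on S.
        ... | no h≰u  = ≤-reflexive (trans (vanishes (height p)) (sym (vanishes (u k))))
          where
          vanishes : ∀ x → x * μ (part p ∩ cell k) ≡ 0#
          vanishes x = trans (cong (x *_) (μ-empty λ t (t∈p , t∈cell) →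
            h≰u (≤-trans (height≤f p t t∈p) (f≤u k t (part⊆S p t∈p) t∈cell)))) (zeroʳ x)

    -- The set E is generalised for the induction: the remaining parts lie in E without the first
    -- part, whose measurability lets the two bounds be added cell by cell.
    simpleIntegral-≤ : ∀ (ps : List (Piece f S)) → AllPairs (λ p q → Disjoint (part p) (part q)) ps →
      ∀ E → All (λ p → ∀ t → t ∈ part p → t ∈ E) ps → simpleIntegral ps ≤ ∑< N (λ k → u k * μ (E ∩ cell k))
    simpleIntegral-≤ []       []                      E []             = ∑-nonNeg N λ k → *-nonNegative (0≤u k) (μ-nonNeg _)
    simpleIntegral-≤ (p ∷ ps) (p-disjoint ∷ disjoint) E (p⊆E ∷ ps⊆E) = begin
      height p * size p + simpleIntegral ps
        ≤⟨ +-mono-≤ (piece≤ p) (simpleIntegral-≤ ps disjoint (E ∩ ∁ (part p))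
             (All.zipWith (λ (q⊆E , p∩q≡∅) t t∈q → q⊆E t t∈q , λ t∈p → p∩q≡∅ t (t∈p , t∈q)) (ps⊆E , p-disjoint))) ⟩
      ∑< N (λ k → u k * μ (part p ∩ cell k)) + ∑< N (λ k → u k * μ ((E ∩ ∁ (part p)) ∩ cell k))
        ≡⟨ sym (∑-distrib-+ N _ _) ⟩
      ∑< N (λ k → u k * μ (part p ∩ cell k) + u k * μ ((E ∩ ∁ (part p)) ∩ cell k))
        ≤⟨ ∑-mono-≤ N (λ k _ → merge k) ⟩
      ∑< N (λ k → u k * μ (E ∩ cell k)) ∎
      where
      open ≤-Reasoning
      merge : ∀ k → u k * μ (part p ∩ cell k) + u k * μ ((E ∩ ∁ (part p)) ∩ cell k) ≤ u k * μ (E ∩ cell k)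
      merge k = begin
        u k * μ (part p ∩ cell k) + u k * μ ((E ∩ ∁ (part p)) ∩ cell k)     ≡⟨ sym (distribˡ (u k) _ _) ⟩
        u k * (μ (part p ∩ cell k) + μ ((E ∩ ∁ (part p)) ∩ cell k))         ≤⟨ *-monoʳ-≤-nonNeg (0≤u k)
          (+-mono-≤ (μ-mono λ t _ (t∈p , c) → (p⊆E t t∈p , c) , t∈p) (μ-mono λ t _ ((e , t∉p) , c) → (e , c) , t∉p)) ⟩
        u k * (μ ((E ∩ cell k) ∩ part p) + μ ((E ∩ cell k) ∩ ∁ (part p)))
          ≡⟨ cong (u k *_) (sym (μ-split (E ∩ cell k) (measurable p))) ⟩
        u k * μ (E ∩ cell k)                                                ∎

    lowerSum-≤ : ∀ {E} → (∀ t → t ∈ S → t ∈ E) → IsUpperBound (LowerSum f S) (∑< N (λ k → u k * μ (E ∩ cell k)))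
    lowerSum-≤ {E} S⊆E s (ps , disjoint , refl) = simpleIntegral-≤ ps disjoint E (All.universal (λ p t t∈p → S⊆E t (part⊆S p t∈p)) ps)

  -- Truncated subtraction gives speed 0 to the cells before r.
  maxSpeed : (r d k : ℕ) → ℕ
  maxSpeed r d k with k ℕ.<? d
  ... | yes _ = suc k ℕ.∸ r
  ... | no _  = 0

  ι-∸-≤ : ∀ m n → ι m - ι n ≤ ι (m ℕ.∸ n)
  ι-∸-≤ m n = rearrange (solve 3 (λ m n x → (m :- n) :+ (n :+ x) := x :+ m) refl (ι m) (ι n) (ι (m ℕ.∸ n)))
    (≤-trans (ι-mono-≤ (ℕ.m≤n+m∸n m n)) (≤-reflexive (ι-+ n (m ℕ.∸ n))))

  work-≤ : ∀ {r d S E} → 1 ℕ.≤ r → d ℕ.≤ N → (∀ t → t ∈ S → ι r ≤ t × t ≤ ι d) → (∀ t → t ∈ S → t ∈ E) →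
    IsUpperBound (LowerSum (λ t → t - ι r) S) (∑< N (λ k → ι (maxSpeed r d k) * μ (E ∩ cell k)))
  work-≤ {r} {d} {S} 1≤r d≤N S⊆[r,d] = lowerSum-≤ (ι ∘ maxSpeed r d) (0≤ι ∘ maxSpeed r d)
    -- A release of at least 1 keeps S strictly after 0, as `Horizon` demands.
    (λ t t∈S → let r≤t , t≤d = S⊆[r,d] t t∈S in <-≤-trans (ι-mono-< 1≤r) r≤t , ≤-trans t≤d (ι-mono-≤ d≤N))
    bound
    where
    bound : ∀ k t → t ∈ S → t ∈ cell k → t - ι r ≤ ι (maxSpeed r d k)
    bound k t t∈S (k<t , t≤1+k) with k ℕ.<? d
    ... | yes _  = ≤-trans (+-monoˡ-≤ (- ι r) t≤1+k) (ι-∸-≤ (suc k) r)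
    ... | no k≮d = ⊥-elim (<⇒≱ k<t (≤-trans (proj₂ (S⊆[r,d] t t∈S)) (ι-mono-≤ (ℕ.≮⇒≥ k≮d))))

-- Weighted processor time and weak duality.

module Loads (R : RealNumbers) (N : ℕ) where
  open RealNumbers R
  open Lebesgue R
  open Scheduling R
  open OrderedField R
  open FiniteSums R
  open OuterMeasures R
  open Intervals R
  open Grid R N

  abstract
    -- A linear form in the times that job j receives in the cells. The coefficients `maxSpeed` make
    -- it an upper bound on work; combinations of coefficients express dual multipliers.
    load : Schedule → ℕ → (ℕ → ℕ) → ℝ
    load σ j c = ∑< N (λ k → ι (c k) * μ (RunsAt σ j ∩ cell k))

    load≡ : ∀ σ j c → load σ j c ≡ ∑< N (λ k → ι (c k) * μ (RunsAt σ j ∩ cell k))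
    load≡ σ j c = refl

    load-mono : ∀ {σ τ j} {c d : ℕ → ℕ} →
      (∀ k → ι (c k) * μ (RunsAt σ j ∩ cell k) ≤ ι (d k) * μ (RunsAt τ j ∩ cell k)) → load σ j c ≤ load τ j d
    load-mono h = ∑-mono-≤ N λ k _ → h k

    load-nonNeg : ∀ σ j c → 0# ≤ load σ j c
    load-nonNeg σ j c = ∑-nonNeg N λ k → *-nonNegative (0≤ι (c k)) (μ-nonNeg _)

    load-+ : ∀ σ j c d → load σ j (λ k → c k ℕ.+ d k) ≡ load σ j c + load σ j d
    load-+ σ j c d = trans
      (∑-cong N λ k → trans (cong (_* μ (RunsAt σ j ∩ cell k)) (ι-+ (c k) (d k))) (distribʳ (μ (RunsAt σ j ∩ cell k)) _ _))
      (∑-distrib-+ N _ _)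

    load-* : ∀ σ j a c → load σ j (λ k → a ℕ.* c k) ≡ ι a * load σ j c
    load-* σ j a c = trans
      (∑-cong N λ k → trans (cong (_* μ (RunsAt σ j ∩ cell k)) (ι-* a (c k))) (*-assoc (ι a) _ _))
      (sym (*-distribˡ-∑ (ι a) N _))

    -- Weak duality for the linear program that distributes the unit cells
    -- among the jobs; p k is the price of cell k.
    ∑-load-≤ : ∀ n σ → (∀ j → Measurable (RunsAt σ j)) → (c : ℕ → ℕ → ℕ) (p : ℕ → ℕ) → (∀ j k → c j k ℕ.≤ p k) →
      ∑< n (λ j → load σ j (c j)) ≤ ι (total N p)
    ∑-load-≤ n σ mσ c p c≤p = begin
      ∑< n (λ j → ∑< N (λ k → ι (c j k) * μ (RunsAt σ j ∩ cell k)))   ≡⟨ ∑-comm n N _ ⟩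
      ∑< N (λ k → ∑< n (λ j → ι (c j k) * μ (RunsAt σ j ∩ cell k)))   ≤⟨ ∑-mono-≤ N (λ k _ → cell≤ k) ⟩
      ∑< N (ι ∘ p)                                                    ≡⟨ sym (ι-total N p) ⟩
      ι (total N p)                                                   ∎
      where
      open ≤-Reasoning
      cell≤ : ∀ k → ∑< n (λ j → ι (c j k) * μ (RunsAt σ j ∩ cell k)) ≤ ι (p k)
      cell≤ k = begin
        ∑< n (λ j → ι (c j k) * μ (RunsAt σ j ∩ cell k))
          ≤⟨ ∑-mono-≤ n (λ j _ → ≤-trans (*-monoˡ-≤-nonNeg (μ-nonNeg _) (ι-mono-≤ (c≤p j k)))
               (*-monoʳ-≤-nonNeg (0≤ι (p k)) (μ-mono λ t _ (r , c) → c , r))) ⟩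
        ∑< n (λ j → ι (p k) * μ (cell k ∩ RunsAt σ j))    ≡⟨ sym (*-distribˡ-∑ (ι (p k)) n _) ⟩
        ι (p k) * ∑< n (λ j → μ (cell k ∩ RunsAt σ j))    ≤⟨ *-monoʳ-≤-nonNeg (0≤ι (p k)) (≤-trans
          (∑-μ-disjoint-≤ n (RunsAt σ) mσ
             (λ i j i≢j t (σt≡i , σt≡j) → i≢j (just-injective (trans (sym σt≡i) σt≡j))) (cell k)) (μ-cell≤1 k)) ⟩
        ι (p k) * 1#                                      ≡⟨ *-identityʳ (ι (p k)) ⟩
        ι (p k)                                           ∎

  load-scale : ∀ {σ j w c} a → ι w ≤ load σ j c → ι (a ℕ.* w) ≤ load σ j (λ k → a ℕ.* c k)
  load-scale {σ} {j} {w} {c} a w≤ = subst₂ _≤_ (sym (ι-* a w)) (sym (load-* σ j a c)) (*-monoʳ-≤-nonNeg (0≤ι a) w≤)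

  load-monoʳ : ∀ {σ j} {c d : ℕ → ℕ} → (∀ k → c k ℕ.≤ d k) → load σ j c ≤ load σ j d
  load-monoʳ c≤d = load-mono λ k → *-monoˡ-≤-nonNeg (μ-nonNeg _) (ι-mono-≤ (c≤d k))

  -- The coefficients vanish from cell y on, so only the part of the schedules up to y matters.
  load-local : ∀ {σ τ j r y} → (∀ t → t ≤ ι y → σ t ≡ τ t) → load τ j (maxSpeed r y) ≤ load σ j (maxSpeed r y)
  load-local {σ} {τ} {j} {r} {y} σ≡τ = load-mono λ k → cell≤ k
    where
    cell≤ : ∀ k → ι (maxSpeed r y k) * μ (RunsAt τ j ∩ cell k) ≤ ι (maxSpeed r y k) * μ (RunsAt σ j ∩ cell k)
    cell≤ k with k ℕ.<? y
    ... | yes k<y = *-monoʳ-≤-nonNeg (0≤ι (suc k ℕ.∸ r)) (μ-mono λ t _ (τt≡j , k<t , t≤1+k) →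
            trans (σ≡τ t (≤-trans t≤1+k (ι-mono-≤ k<y))) τt≡j , k<t , t≤1+k)
    ... | no _    = ≤-reflexive (trans (zeroˡ _) (sym (zeroˡ _)))

  -- Jobs with integer data and a necessary condition for their completion.

  record Spec : Set where
    field
      r d w : ℕ
      1≤r   : 1 ℕ.≤ r
      r<d   : r ℕ.< d
      d≤N   : d ℕ.≤ N
      0<w   : 0 ℕ.< w
  open Spec

  toJob : Spec → Job
  toJob p = record
    { release = ι (r p) ; due = ι (d p) ; work = ι (w p) ; release<due = ι-mono-< (r<d p) ; 0<work = ι-mono-< (0<w p) }

  -- The upper-sum relaxation of completion by the due date. As a comparison of two reals it is
  -- decidable.
  MayComplete : Schedule → ℕ → Spec → Set
  MayComplete σ j p = ι (w p) ≤ load σ j (maxSpeed (r p) (d p))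

  -- If T ≤ d, the upper sum bounds all lower sums up to T, hence their supremum v.
  ¬mayComplete⇒late : ∀ σ j p → ¬ MayComplete σ j p → ∀ T →
    ∃[ v ] Integral (speed (toJob p)) (λ t → RunsAt σ j t × ι (r p) ≤ t × t ≤ T) v × ι (w p) ≤ v → ι (d p) < T
  ¬mayComplete⇒late σ j p ¬may T (v , (_ , v-least) , w≤v) = ≰⇒> λ T≤d → ¬may (≤-trans w≤v (≤-trans
    (v-least _ (work-≤ (1≤r p) (d≤N p) (λ t (_ , r≤t , t≤T) → r≤t , ≤-trans t≤T T≤d) (λ t → proj₁)))
    (≤-reflexive (sym (load≡ σ j _)))))

  -- Lower bounds on integrals, for feasibility.

  module _ {r a : ℕ} {S : Subset} (r≤a : r ℕ.≤ a) where
    -- On each unit cell the step function takes the speed at the left end.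
    lowerSum-cells : ∀ n → (∀ t → t ∈ ⟨ ι a , ι (a ℕ.+ n) ] → t ∈ S) →
      LowerSum (λ t → t - ι r) S (ι (total n λ i → a ℕ.+ i ℕ.∸ r))
    lowerSum-cells n ⊆S = let ps , disjoint , _ , eq = cells n ⊆S in ps , disjoint , sym eq
      where
      open Piece
      -- The bound on the parts so far makes the next cell disjoint from them.
      cells : ∀ n → (∀ t → t ∈ ⟨ ι a , ι (a ℕ.+ n) ] → t ∈ S) → ∃[ ps ]
        AllPairs (λ p q → Disjoint (part p) (part q)) ps ×
        All (λ p → ∀ t → t ∈ part p → t ≤ ι (a ℕ.+ n)) ps ×
        simpleIntegral {λ t → t - ι r} {S} ps ≡ ι (total n λ i → a ℕ.+ i ℕ.∸ r)
      cells zero    ⊆S = [] , [] , [] , refl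
      cells (suc n) ⊆S =
        let ps , disjoint , ps≤ , eq = cells n (λ t (a<t , t≤) → ⊆S t (a<t , ≤-trans t≤ (≤-trans (ι-mono-≤ (ℕ.n≤1+n (a ℕ.+ n))) 1+≤)))
        in new ∷ ps
         , All.map (λ q≤ t (( a+n<t , _) , t∈q) → <⇒≱ a+n<t (q≤ t t∈q)) ps≤ ∷ disjoint
         , (λ t (_ , t≤) → ≤-trans t≤ 1+≤) ∷ All.map (λ q≤ t t∈q → ≤-trans (q≤ t t∈q) (≤-trans (ι-mono-≤ (ℕ.n≤1+n (a ℕ.+ n))) 1+≤)) ps≤
         , trans (cong₂ _+_ (*-identityʳ _) eq) (trans (+-comm _ _) (sym (ι-+ (total n λ i → a ℕ.+ i ℕ.∸ r) (a ℕ.+ n ℕ.∸ r))))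
        where
        1+≤ : ι (suc (a ℕ.+ n)) ≤ ι (a ℕ.+ suc n)
        1+≤ = ι-mono-≤ (ℕ.≤-reflexive (sym (ℕ.+-suc a n)))
        new : Piece (λ t → t - ι r) S
        new = record
          { height = ι (a ℕ.+ n ℕ.∸ r) ; part = cell (a ℕ.+ n) ; size = 1#
          ; 0≤height = 0≤ι (a ℕ.+ n ℕ.∸ r)
          ; part⊆S = λ {t} (a+n<t , t≤) → ⊆S t (≤-<-trans (ι-mono-≤ (ℕ.m≤m+n a n)) a+n<t , ≤-trans t≤ 1+≤)
          ; height≤f = λ t (a+n<t , _) → rearrange (solve 3 (λ h t r → h :+ t := (t :- r) :+ (h :+ r)) refl (ι (a ℕ.+ n ℕ.∸ r)) t (ι r))
              (≤-trans (≤-reflexive (trans (sym (ι-+ (a ℕ.+ n ℕ.∸ r) r)) (cong ι (ℕ.m∸n+n≡m (ℕ.≤-trans r≤a (ℕ.m≤m+n a n)))))) (<⇒≤ a+n<t))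
          ; measurable = Measurable-interval _ _
          ; measure = cell-measure (a ℕ.+ n) }

  -- A sufficient condition, in ℕ alone, for finishing the job in one uninterrupted slot: its work
  -- is compared with the lower sum.
  record Fits (p : Spec) (start len : ℕ) : Set where
    field
      r≤start : r p ℕ.≤ start
      end≤d   : start ℕ.+ len ℕ.≤ d p
      w≤total : w p ℕ.≤ total len (λ i → start ℕ.+ i ℕ.∸ r p)

  -- The upper sum bounds the lower sums, so by completeness the integral exists; it is at least the
  -- lower sum over the slot.
  completes : ∀ {p start len σ j} → Fits p start len → (∀ t → t ∈ ⟨ ι start , ι (start ℕ.+ len) ] → RunsAt σ j t) →
    ∃[ v ] Integral (speed (toJob p)) (λ t → RunsAt σ j t × ι (r p) ≤ t × t ≤ ι (d p)) v × ι (w p) ≤ v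
  completes {p} {start} {len} {σ} {j} fits runs =
    let v , v-sup = complete (LowerSum (speed (toJob p)) S) (_ , lowerSum) (_ , work-≤ (1≤r p) (d≤N p) (λ t → proj₂) (λ t → proj₁))
    in v , v-sup , ≤-trans (ι-mono-≤ w≤total) (proj₁ v-sup _ lowerSum)
    where
    open Fits fits
    S : Subset
    S t = RunsAt σ j t × ι (r p) ≤ t × t ≤ ι (d p)
    lowerSum : LowerSum (speed (toJob p)) S (ι (total len λ i → start ℕ.+ i ℕ.∸ r p))
    lowerSum = lowerSum-cells r≤start len λ t t∈@(s<t , t≤e) →
      runs t t∈ , ≤-trans (ι-mono-≤ r≤start) (<⇒≤ s<t) , ≤-trans t≤e (ι-mono-≤ end≤d)

  -- Schedules made of one slot per job.

  ⟨_,_]? : ∀ a b → Decidable ⟨ a , b ]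
  ⟨ a , b ]? t with t ≤? a | t ≤? b
  ... | yes t≤a | _       = no λ (a<t , _) → <⇒≱ a<t t≤a
  ... | no _    | no t≰b  = no λ (_ , t≤b) → t≰b t≤b
  ... | no t≰a  | yes t≤b = yes (≰⇒> t≰a , t≤b)

  module Timetable (start end : ℕ → ℕ) (separate : ∀ {i j} → i ℕ.< j → end i ℕ.≤ start j ⊎ end j ℕ.≤ start i) where
    slot : ℕ → Subset
    slot j = ⟨ ι (start j) , ι (end j) ]

    timetable : ℕ → Schedule
    timetable zero    t = nothing
    timetable (suc n) t with ⟨ ι (start n) , ι (end n) ]? t
    ... | yes _ = just n
    ... | no _  = timetable n t

    runs⇒slot : ∀ n j t → RunsAt (timetable n) j t → t ∈ slot j
    runs⇒slot (suc n) j t σt≡j with ⟨ ι (start n) , ι (end n) ]? t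
    runs⇒slot (suc n) .n t refl | yes t∈ = t∈
    runs⇒slot (suc n) j t σt≡j  | no _   = runs⇒slot n j t σt≡j

    slot-disjoint : ∀ {i j} → i ℕ.< j → Disjoint (slot i) (slot j)
    slot-disjoint i<j t ((si<t , t≤ei) , (sj<t , t≤ej)) with separate i<j
    ... | inj₁ ei≤sj = <⇒≱ sj<t (≤-trans t≤ei (ι-mono-≤ ei≤sj))
    ... | inj₂ ej≤si = <⇒≱ si<t (≤-trans t≤ej (ι-mono-≤ ej≤si))

    slot⇒runs : ∀ n j t → j ℕ.< n → t ∈ slot j → RunsAt (timetable n) j t
    slot⇒runs (suc n) j t j<1+n t∈ with ⟨ ι (start n) , ι (end n) ]? t | ℕ.m<1+n⇒m<n∨m≡n j<1+n
    ... | yes _   | inj₂ refl = refl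
    ... | no t∉   | inj₂ refl = ⊥-elim (t∉ t∈)
    ... | yes t∈′ | inj₁ j<n  = ⊥-elim (slot-disjoint j<n t (t∈ , t∈′))
    ... | no _    | inj₁ j<n  = slot⇒runs n j t j<n t∈

    timetable-measurable : ∀ n j → Measurable (RunsAt (timetable n) j)
    timetable-measurable n j with j ℕ.<? n
    ... | yes j<n = Measurable-resp (λ t → slot⇒runs n j t j<n) (runs⇒slot n j) (Measurable-interval _ _)
    -- Positions from n on never run; their set of times is written as an empty interval.
    ... | no j≮n  = Measurable-resp {⟨ 0# , 0# ]} (λ t (0<t , t≤0) → ⊥-elim (<⇒≱ 0<t t≤0))
      (λ t runs → ⊥-elim (j≮n (runs⇒< n t runs))) (Measurable-interval _ _)
      where
      runs⇒< : ∀ n t → RunsAt (timetable n) j t → j ℕ.< n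
      runs⇒< (suc n) t σt≡j with ⟨ ι (start n) , ι (end n) ]? t
      runs⇒< (suc n) t refl | yes _ = ℕ.n<1+n n
      runs⇒< (suc n) t σt≡j | no _  = ℕ.m<n⇒m<1+n (runs⇒< n t σt≡j)

  -- Streams of three jobs.

  module ThreeJobs (p₀ p₁ p₂ : Spec) (r₀≤r₁ : r p₀ ℕ.≤ r p₁) (r₁≤r₂ : r p₁ ℕ.≤ r p₂) where
    stream : JobStream
    stream = record
      { jobs   = toJob p₀ ∷ toJob p₁ ∷ toJob p₂ ∷ []
      ; sorted = (ι-mono-≤ r₀≤r₁ ∷ ι-mono-≤ (ℕ.≤-trans r₀≤r₁ r₁≤r₂) ∷ []) ∷ (ι-mono-≤ r₁≤r₂ ∷ []) ∷ [] ∷ [] }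

    stream-feasible : ∀ {s₀ n₀ s₁ n₁ s₂ n₂} → Fits p₀ s₀ n₀ → Fits p₁ s₁ n₁ → Fits p₂ s₂ n₂ →
      s₀ ℕ.+ n₀ ℕ.≤ s₁ ⊎ s₁ ℕ.+ n₁ ℕ.≤ s₀ → s₀ ℕ.+ n₀ ℕ.≤ s₂ ⊎ s₂ ℕ.+ n₂ ℕ.≤ s₀ → s₁ ℕ.+ n₁ ℕ.≤ s₂ ⊎ s₂ ℕ.+ n₂ ℕ.≤ s₁ →
      Feasible stream
    stream-feasible {s₀} {n₀} {s₁} {n₁} {s₂} {n₂} fits₀ fits₁ fits₂ separate₀₁ separate₀₂ separate₁₂ = timetable 3 , record
      { measurable   = timetable-measurable 3
      ; withinWindow = λ
          { 0F → within fits₀ (runs⇒slot 3 0) ; 1F → within fits₁ (runs⇒slot 3 1) ; 2F → within fits₂ (runs⇒slot 3 2) }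
      ; meetsDueDate = λ
          { 0F → completes fits₀ λ t → slot⇒runs 3 0 t (ℕ.s≤s ℕ.z≤n)
          ; 1F → completes fits₁ λ t → slot⇒runs 3 1 t (ℕ.s≤s (ℕ.s≤s ℕ.z≤n))
          ; 2F → completes fits₂ λ t → slot⇒runs 3 2 t (ℕ.s≤s (ℕ.s≤s (ℕ.s≤s ℕ.z≤n))) } }
      where
      start end : ℕ → ℕ
      start 0 = s₀
      start 1 = s₁
      start 2 = s₂
      -- Other positions get an empty slot at 0, which ends no later than any slot starts.
      start (suc (suc (suc _))) = 0
      end 0 = s₀ ℕ.+ n₀
      end 1 = s₁ ℕ.+ n₁
      end 2 = s₂ ℕ.+ n₂
      end (suc (suc (suc _))) = 0
      separate : ∀ {i j} → i ℕ.< j → end i ℕ.≤ start j ⊎ end j ℕ.≤ start i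
      separate {0} {1} _ = separate₀₁
      separate {0} {2} _ = separate₀₂
      separate {1} {2} _ = separate₁₂
      separate {1} {1} (ℕ.s≤s ())
      separate {suc (suc i)} {1} (ℕ.s≤s ())
      separate {suc (suc i)} {2} (ℕ.s≤s (ℕ.s≤s ()))
      separate {i} {suc (suc (suc _))} _ = inj₂ ℕ.z≤n
      open Timetable start end separate
      within : ∀ {p s n j} → Fits p s n → (∀ t → RunsAt (timetable 3) j t → t ∈ ⟨ ι s , ι (s ℕ.+ n) ]) →
        ∀ t → t ∈ RunsAt (timetable 3) j → ι (r p) ≤ t × t ≤ ι (d p)
      within fits runs⇒ t runs = let s<t , t≤e = runs⇒ t runs in
        ≤-trans (ι-mono-≤ (Fits.r≤start fits)) (<⇒≤ s<t) , ≤-trans t≤e (ι-mono-≤ (Fits.end≤d fits))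

    someJobLate : ∀ σ → ¬ (MayComplete σ 0 p₀ × MayComplete σ 1 p₁ × MayComplete σ 2 p₂) → ∃[ j ] MissesDueDate stream σ j
    someJobLate σ ¬all = decide (_ ≤? _) (_ ≤? _) (_ ≤? _)
      where
      decide : Dec (MayComplete σ 0 p₀) → Dec (MayComplete σ 1 p₁) → Dec (MayComplete σ 2 p₂) → ∃[ j ] MissesDueDate stream σ j
      decide (no ¬d₀) _        _        = 0F , ¬mayComplete⇒late σ 0 p₀ ¬d₀
      decide (yes _)  (no ¬d₁) _        = 1F , ¬mayComplete⇒late σ 1 p₁ ¬d₁
      decide (yes _)  (yes _)  (no ¬d₂) = 2F , ¬mayComplete⇒late σ 2 p₂ ¬d₂
      decide (yes d₀) (yes d₁) (yes d₂) = ⊥-elim (¬all (d₀ , d₁ , d₂))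

    -- Up to time y the third job is still invisible, so streams that differ only in this job look
    -- alike to the algorithm.
    releasedBy-early : ∀ {y t} → y ℕ.< r p₂ → t ≤ ι y → releasedBy t (jobs stream) ≡ releasedBy t (toJob p₀ ∷ toJob p₁ ∷ [])
    releasedBy-early {y} {t} y<r₂ t≤y = trans (filter-++ (λ j → release j ≤? t) (toJob p₀ ∷ toJob p₁ ∷ []) (toJob p₂ ∷ []))
      (trans (cong (releasedBy t (toJob p₀ ∷ toJob p₁ ∷ []) ++_)
        (filter-reject (λ j → release j ≤? t) λ r₂≤t → <⇒≱ (ι-mono-< y<r₂) (≤-trans r₂≤t t≤y)))
        (++-identityʳ _))

  -- Dual certificates that some job is late.

  earlySpeed : ℕ → Spec → ℕ → ℕ
  earlySpeed y p = maxSpeed (r p) y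

  lateSpeed : ℕ → Spec → ℕ → ℕ
  lateSpeed y p k = maxSpeed (r p) (d p) k ℕ.∸ earlySpeed y p k

  -- The cheapest dual solution for given multipliers of the jobs.
  price : (a b c : ℕ → ℕ) → ℕ → ℕ
  price a b c k = a k ℕ.⊔ (b k ℕ.⊔ c k)

  load₃-≤ : ∀ σ → (∀ j → Measurable (RunsAt σ j)) → ∀ a b c → load σ 0 a + (load σ 1 b + load σ 2 c) ≤ ι (total N (price a b c))
  load₃-≤ σ mσ a b c = ≤-trans
    (≤-reflexive (solve 3 (λ x y z → x :+ (y :+ z) := ((con (ℤ.+ 0) :+ x) :+ y) :+ z) refl (load σ 0 a) (load σ 1 b) (load σ 2 c)))
    (∑-load-≤ 3 σ mσ weights (price a b c) weights≤)
    where
    weights : ℕ → ℕ → ℕ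
    weights 0 = a
    weights 1 = b
    weights 2 = c
    weights (suc (suc (suc _))) = λ _ → 0
    weights≤ : ∀ j k → weights j k ℕ.≤ price a b c k
    weights≤ 0 k = ℕ.m≤m⊔n (a k) _
    weights≤ 1 k = ℕ.≤-trans (ℕ.m≤m⊔n (b k) _) (ℕ.m≤n⊔m (a k) _)
    weights≤ 2 k = ℕ.≤-trans (ℕ.m≤n⊔m (b k) _) (ℕ.m≤n⊔m (a k) _)
    weights≤ (suc (suc (suc _))) k = ℕ.z≤n

  module _ {σ : Schedule} (mσ : ∀ j → Measurable (RunsAt σ j)) (y θ : ℕ) (p₀ p₁ p₂ : Spec) where
    private
      _⊛_ : ℕ → Spec → ℕ → ℕ
      (a ⊛ p) k = a ℕ.* maxSpeed (r p) (d p) k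

      -- Two constraints concern job 1, its whole work and its early work, and their multiples
      -- combine into one coefficient per cell.
      boosted : ℕ → ℕ → ℕ → ℕ
      boosted b e k = (b ⊛ p₁) k ℕ.+ e ℕ.* earlySpeed y p₁ k

    -- a, b and c are the multipliers of the jobs, e is the multiplier of the
    -- constraint that the early work on job 1 is at least θ.
    eager-fails : ∀ a b c e →
      total N (price (a ⊛ p₀) (boosted b e) (c ⊛ p₂)) ℕ.< a ℕ.* w p₀ ℕ.+ (b ℕ.* w p₁ ℕ.+ e ℕ.* θ ℕ.+ c ℕ.* w p₂) →
      ι θ ≤ load σ 1 (earlySpeed y p₁) → ¬ (MayComplete σ 0 p₀ × MayComplete σ 1 p₁ × MayComplete σ 2 p₂)
    eager-fails a b c e total< θ≤ (d₀ , d₁ , d₂) = ℕ.<⇒≱ total< (ι-cancel-≤ (begin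
      ι (a ℕ.* w p₀ ℕ.+ (b ℕ.* w p₁ ℕ.+ e ℕ.* θ ℕ.+ c ℕ.* w p₂))
        ≡⟨ trans (ι-+ (a ℕ.* w p₀) _) (cong (ι (a ℕ.* w p₀) +_) (trans (ι-+ (b ℕ.* w p₁ ℕ.+ e ℕ.* θ) _)
             (cong (_+ ι (c ℕ.* w p₂)) (ι-+ (b ℕ.* w p₁) _)))) ⟩
      ι (a ℕ.* w p₀) + ((ι (b ℕ.* w p₁) + ι (e ℕ.* θ)) + ι (c ℕ.* w p₂))
        ≤⟨ +-mono-≤ (load-scale a d₀) (+-mono-≤ (+-mono-≤ (load-scale b d₁) (load-scale e θ≤)) (load-scale c d₂)) ⟩
      load σ 0 (a ⊛ p₀) + ((load σ 1 (b ⊛ p₁) + load σ 1 (λ k → e ℕ.* earlySpeed y p₁ k)) + load σ 2 (c ⊛ p₂))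
        ≡⟨ cong (λ x → load σ 0 (a ⊛ p₀) + (x + load σ 2 (c ⊛ p₂))) (sym (load-+ σ 1 (b ⊛ p₁) (λ k → e ℕ.* earlySpeed y p₁ k))) ⟩
      load σ 0 (a ⊛ p₀) + (load σ 1 (boosted b e) + load σ 2 (c ⊛ p₂))
        ≤⟨ load₃-≤ σ mσ (a ⊛ p₀) (boosted b e) (c ⊛ p₂) ⟩
      ι (total N (price (a ⊛ p₀) (boosted b e) (c ⊛ p₂))) ∎))
      where open ≤-Reasoning

    -- Job 1 has multiplier 1 and job 0 has multiplier 0. At most θ of job 1 is done early, and the
    -- rest competes with job 2 for the cells from y on.
    lazy-fails : ∀ c →
      θ ℕ.+ total N (price (λ _ → 0) (lateSpeed y p₁) (c ⊛ p₂)) ℕ.< w p₁ ℕ.+ c ℕ.* w p₂ →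
      load σ 1 (earlySpeed y p₁) ≤ ι θ → ¬ (MayComplete σ 0 p₀ × MayComplete σ 1 p₁ × MayComplete σ 2 p₂)
    lazy-fails c total< ≤θ (_ , d₁ , d₂) = ℕ.<⇒≱ total< (ι-cancel-≤ (begin
      ι (w p₁ ℕ.+ c ℕ.* w p₂)
        ≡⟨ ι-+ (w p₁) _ ⟩
      ι (w p₁) + ι (c ℕ.* w p₂)
        ≤⟨ +-mono-≤ (≤-trans d₁ (load-monoʳ λ k → ℕ.m≤n+m∸n _ (earlySpeed y p₁ k))) (load-scale c d₂) ⟩
      load σ 1 (λ k → earlySpeed y p₁ k ℕ.+ lateSpeed y p₁ k) + load σ 2 (c ⊛ p₂)
        ≡⟨ cong (_+ load σ 2 (c ⊛ p₂)) (load-+ σ 1 (earlySpeed y p₁) (lateSpeed y p₁)) ⟩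
      (load σ 1 (earlySpeed y p₁) + load σ 1 (lateSpeed y p₁)) + load σ 2 (c ⊛ p₂)
        ≡⟨ +-assoc _ _ _ ⟩
      load σ 1 (earlySpeed y p₁) + (load σ 1 (lateSpeed y p₁) + load σ 2 (c ⊛ p₂))
        -- Job 0 enters with zero coefficients to match the bound for three jobs.
        ≤⟨ +-mono-≤ ≤θ (≤-trans (x≤x+y (load-nonNeg σ 0 (λ _ → 0))) (≤-reflexive (+-comm _ _))) ⟩
      ι θ + (load σ 0 (λ _ → 0) + (load σ 1 (lateSpeed y p₁) + load σ 2 (c ⊛ p₂)))
        ≤⟨ +-monoʳ-≤ (ι θ) (load₃-≤ σ mσ (λ _ → 0) (lateSpeed y p₁) (c ⊛ p₂)) ⟩
      ι θ + ι (total N (price (λ _ → 0) (lateSpeed y p₁) (c ⊛ p₂)))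
        ≡⟨ sym (ι-+ θ _) ⟩
      ι (θ ℕ.+ total N (price (λ _ → 0) (lateSpeed y p₁) (c ⊛ p₂))) ∎))
      where open ≤-Reasoning

-- The two concrete streams and the adversary's choice.

module Adversary (R : RealNumbers) where
  open RealNumbers R
  open Scheduling R
  open OrderedField R
  open Loads R 120

  private
    by-evaluation : ∀ {m n} {_ : Bool.T (m ℕ.≤ᵇ n)} → m ℕ.≤ n
    by-evaluation {m} {n} {m≤ᵇn} = ℕ.≤ᵇ⇒≤ m n m≤ᵇn

    spec : (r d w : ℕ) {_ : Bool.T (1 ℕ.≤ᵇ r)} {_ : Bool.T (r ℕ.<ᵇ d)} {_ : Bool.T (d ℕ.≤ᵇ 120)} {_ : Bool.T (0 ℕ.<ᵇ w)} → Spec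
    spec r d w {1≤r} {r<d} {d≤N} {0<w} = record
      { r = r ; d = d ; w = w
      ; 1≤r = ℕ.≤ᵇ⇒≤ 1 r 1≤r ; r<d = ℕ.<ᵇ⇒< r d r<d ; d≤N = ℕ.≤ᵇ⇒≤ d 120 d≤N ; 0<w = ℕ.<ᵇ⇒< 0 w 0<w }

    -- The works are the largest for which the slots below suffice; the threshold
    -- 700 and the multipliers 3, 4, 10, 2 and 4 are roundings of optimal solutions
    -- of the two linear programs.
    job₀ job₁ long short : Spec
    job₀  = spec 1 120 2485
    job₁  = spec 24 96 1428
    long  = spec 67 120 972
    short = spec 67 96 351

    module Long  = ThreeJobs job₀ job₁ long by-evaluation by-evaluation
    module Short = ThreeJobs job₀ job₁ short by-evaluation by-evaluation

    fits : ∀ {p s n} {_ : Bool.T (Spec.r p ℕ.≤ᵇ s)} {_ : Bool.T (s ℕ.+ n ℕ.≤ᵇ Spec.d p)}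
           {_ : Bool.T (Spec.w p ℕ.≤ᵇ total n (λ i → s ℕ.+ i ℕ.∸ Spec.r p))} → Fits p s n
    fits {_} {_} {_} {r≤s} {e≤d} {w≤} = record
      { r≤start = ℕ.≤ᵇ⇒≤ _ _ r≤s ; end≤d = ℕ.≤ᵇ⇒≤ _ _ e≤d ; w≤total = ℕ.≤ᵇ⇒≤ _ _ w≤ }

    long-feasible : Feasible Long.stream
    -- Without idling from time 1 to 120: job 0, job 1, then the long job.
    long-feasible = Long.stream-feasible {1} {71} {72} {24} {96} {24} fits fits fits
      (inj₁ by-evaluation) (inj₁ by-evaluation) (inj₁ by-evaluation)

    short-feasible : Feasible Short.stream
    -- Job 1 runs from its release at 24 to 78, the short job to 96 and job 0 to 120.
    short-feasible = Short.stream-feasible {96} {24} {24} {54} {78} {18} fits fits fits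
      (inj₂ by-evaluation) (inj₂ by-evaluation) (inj₁ by-evaluation)

  module _ (alg : OnlineAlgorithm) where
    open OnlineAlgorithm alg

    private
      -- The early work is measured on the long stream; both streams agree up to time 66, before the
      -- third release at 67.
      Eager : Set
      Eager = ι 700 ≤ load (run alg Long.stream) 1 (earlySpeed 66 job₁)

      agree : ∀ t → t ≤ ι 66 → run alg Long.stream t ≡ run alg Short.stream t
      agree t t≤66 = cong (λ known → mapMaybe toℕ (decide t known))
        (trans (Long.releasedBy-early {66} by-evaluation t≤66) (sym (Short.releasedBy-early {66} by-evaluation t≤66)))

      eager-late : Eager → ∃[ j ] MissesDueDate Long.stream (run alg Long.stream) j
      eager-late eager = Long.someJobLate (run alg Long.stream)
        (eager-fails (measurable Long.stream) 66 700 job₀ job₁ long 3 4 10 2 by-evaluation eager)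

      lazy-late : ¬ Eager → ∃[ j ] MissesDueDate Short.stream (run alg Short.stream) j
      lazy-late lazy = Short.someJobLate (run alg Short.stream)
        (lazy-fails (measurable Short.stream) 66 700 job₀ job₁ short 4 by-evaluation
          -- The bound on early work carries over from the long stream to the short one.
          (≤-trans (load-local {r = 24} {y = 66} agree) (<⇒≤ (≰⇒> lazy))))

      adversary : Dec Eager → ∃[ J ] Feasible J × (∃[ j ] MissesDueDate J (run alg J) j)
      adversary (yes eager) = Long.stream , long-feasible , eager-late eager
      adversary (no lazy)   = Short.stream , short-feasible , lazy-late lazy

    someJobLate : ∃[ J ] Feasible J × (∃[ j ] MissesDueDate J (run alg J) j)
    someJobLate = adversary (ι 700 ≤? load (run alg Long.stream) 1 (earlySpeed 66 job₁))

theorem3 : (R : RealNumbers) → let open Scheduling R in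
    (alg : OnlineAlgorithm) →
    ∃[ J ] Feasible J × (∃[ j ] MissesDueDate J (run alg J) j)
theorem3 = Adversary.someJobLate
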